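{- Let $t\geqslant 3$ be a fixed integer and let $H_t$ denote the $1$-subdivision of the complete graph $K_t$. Then \[ f_{2}(n,H_{t})=\Omega\!\left(n^{1+\frac{1}{2t-3}}\right) \quad\text{as } n\to\infty. \]
   Context: The $1$-subdivision $H_t$ of $K_t$ is the graph obtained from $K_t$ by replacing each edge with a path of length $2$ (i.e. inserting one new vertex on each edge). For a proper edge-coloring of the complete graph $K_n$, two vertex-disjoint copies of a graph $H$ are called color isomorphic if there is an isomorphism between them that maps each edge to an edge of the same color. For an integer $k\geqslant 2$ and a graph $H$, $f_k(n,H)$ is the smallest number $C$ such that there exists a proper edge-coloring of $K_n$ using $C$ colors which contains no $k$ pairwise vertex-disjoint, pairwise color isomorphic copies of $H$. -}

module Defs where

open import Data.Nat using (ℕ; _<_)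
open import Data.Fin using (Fin; toℕ)
open import Data.Product using (Σ; _×_; _,_; proj₁; proj₂)
open import Data.Sum using (_⊎_; inj₁; inj₂)
open import Relation.Binary.PropositionalEquality using (_≡_; _≢_)
open import Function.Definitions using (Injective)

Pair : ℕ → Set
Pair t = Σ (Fin t × Fin t) (λ p → toℕ (proj₁ p) < toℕ (proj₂ p))

-- Vertex set of the 1-subdivision H_t of K_t:
-- branch vertices (one per vertex of K_t) and subdivision vertices (one per edge of K_t).
-- The edges of H_t are exactly  branch i -- sub {i,j}  and  branch j -- sub {i,j}.
SubdivVertex : ℕ → Set
SubdivVertex t = Fin t ⊎ Pair t

branch : ∀ {t} → Fin t → SubdivVertex t
branch = inj₁

sub : ∀ {t} → Pair t → SubdivVertex t
sub = inj₂

lo hi : ∀ {t} → Pair t → Fin t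
lo e = proj₁ (proj₁ e)
hi e = proj₂ (proj₁ e)

-- An edge-colouring of K_n (vertex set Fin n) with colours Fin C, given as a
-- symmetric function on ordered pairs of distinct vertices (diagonal values irrelevant).
EdgeColouring : ℕ → ℕ → Set
EdgeColouring n C = Fin n → Fin n → Fin C

Proper : ∀ {n C} → EdgeColouring n C → Set
Proper {n} c =
  (∀ (u v : Fin n) → u ≢ v → c u v ≡ c v u) ×
  (∀ (u v w : Fin n) → u ≢ v → u ≢ w → v ≢ w → c u v ≢ c u w)

-- A copy of H_t in K_n: an injective map of the vertices of H_t into Fin n
-- (every such map is an embedding since the host graph is complete).
Copy : ℕ → ℕ → Set
Copy t n = Σ (SubdivVertex t → Fin n) (λ φ → Injective _≡_ _≡_ φ)

-- Two copies φ, ψ are vertex-disjoint and color isomorphic (via the isomorphism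
-- φ(x) ↦ ψ(x)), i.e. every edge of H_t gets the same colour under φ and ψ.
DisjointColourIsomorphic : ∀ {t n C} → EdgeColouring n C → Copy t n → Copy t n → Set
DisjointColourIsomorphic {t} c (φ , _) (ψ , _) =
  (∀ x y → φ x ≢ ψ y) ×
  (∀ (e : Pair t) →
      (c (φ (branch (lo e))) (φ (sub e)) ≡ c (ψ (branch (lo e))) (ψ (sub e))) ×
      (c (φ (branch (hi e))) (φ (sub e)) ≡ c (ψ (branch (hi e))) (ψ (sub e))))

Contains2 : ∀ {n C} → ℕ → EdgeColouring n C → Set
Contains2 {n} t c = Σ (Copy t n) (λ P → Σ (Copy t n) (λ Q → DisjointColourIsomorphic c P Q))

-- C is admissible for f_2(n, H_t): some proper colouring of K_n with (at most) C
-- colours contains no two vertex-disjoint colour isomorphic copies of H_t.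
-- f_2(n,H_t) is the least admissible C.
Admissible2 : ℕ → ℕ → ℕ → Set
Admissible2 t n C = Σ (EdgeColouring n C) (λ c → Proper c × (Contains2 t c → Data.Empty.⊥))
  where import Data.Empty

{-# OPTIONS --safe #-}

-- Split K_n into halves A and B, and join a pair (x₁ , x₂) of vertices of A to a pair
-- (y₁ , y₂) of vertices of B when x₁y₁ and x₂y₂ have the same colour.  Two colour
-- isomorphic disjoint copies of H_t are a copy of H_t in this graph whose vertices have
-- pairwise distinct coordinates.  By Cauchy–Schwarz over the colour classes the graph has
-- about n⁴/C edges on n² vertices, so the claim becomes Janzer's bound N^(3/2 - 1/(4t-6))
-- for the extremal number of H_t.
--
-- Call two branch vertices heavy if they have at least 2t² common neighbours.  A heavy
-- t-clique extends greedily to H_t, so inside every neighbourhood a positive fraction of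
-- the pairs is not heavy.  Hence every large set U contains a vertex joined by light
-- pairs to a fraction δ²/M of U; iterating t - 1 times gives a light t-clique.  At each
-- round O(1) vertices y are forbidden because they would make subdivision vertices
-- clash, which costs only O(1) times the maximal degree D.
module Submission where

open import Defs
open import Data.Bool using (Bool; true; false; not; _∧_; _xor_; T)
open import Data.Bool.Properties using (T?)
open import Data.Empty using (⊥; ⊥-elim)
open import Data.Fin as Fin using (Fin; zero; suc; inject≤; _↑ˡ_; _↑ʳ_; splitAt)
open import Data.Fin.Properties using (inject≤-injective; ↑ˡ-injective; ↑ʳ-injective; splitAt-↑ˡ; splitAt-↑ʳ) renaming (_≟_ to _≟ᶠ_)
open import Data.List using (List; []; _∷_; length; filter; allFin; cartesianProduct; tabulate; map; _++_)
open import Data.List.Membership.Propositional using (_∈_)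
open import Data.List.Membership.Propositional.Properties using (∈-filter⁻; ∈-++⁺ˡ; ∈-++⁺ʳ; ∈-tabulate⁺; ∈-allFin)
open import Data.List.Properties using (length-++; length-tabulate)
open import Data.List.Relation.Unary.All using (All; []; _∷_)
open import Data.List.Relation.Unary.AllPairs using ([]; _∷_)
open import Data.List.Relation.Unary.Any using (here; there)
open import Data.List.Relation.Unary.Unique.Propositional using (Unique)
open import Data.List.Relation.Unary.Unique.Propositional.Properties using (filter⁺; allFin⁺; cartesianProduct⁺)
open import Data.Nat
open import Data.Nat.DivMod using (m/n*n≤m; m≥n⇒m/n>0; /-monoˡ-≤; m*n/n≡m; m≡m%n+[m/n]*n; m%n<n)
open import Data.Nat.Properties
open import Data.Nat.Tactic.RingSolver using (solve-∀)
open import Data.Product using (Σ; ∃; _×_; _,_; proj₁; proj₂)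
open import Data.Product.Properties using (≡-dec)
open import Data.Sum using (_⊎_; inj₁; inj₂)
open import Function using (_∘_; id)
open import Relation.Binary.PropositionalEquality
open import Relation.Nullary using (¬_; Dec; yes; no; does)
open import Relation.Nullary.Decidable using (¬?; _×-dec_)

-- The exponent comes from what must be left at the end. One round turns e edges at `U` into at
-- least e δ² / κ, where κ is a constant times M. After t - 2 such rounds, and a last one that only
-- has to leave some vertex over, e δ^(2t-3) / κ^(t-1) must still exceed a constant times D; as D is
-- about e / M, this asks that δ^(2t-3) exceed a constant times M^(t-2). Only the maximal degree on
-- the `Y` side and the minimal degree on the other side enter. `Y` stays fixed while `U` shrinks,
-- so both survive every round and no almost regular subgraph has to be found. The obstacle peculiar
-- to this graph is that the vertices of a copy must differ in both coordinates, and that first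
-- coordinates must avoid second ones. Properness settles much of the former, since neighbours of
-- one vertex that share a coordinate coincide. The latter is arranged beforehand by cutting each
-- half in two, at the price of a factor 16. The existence of the subdivision is only obtained
-- doubly negated, which suffices for refuting a colouring.

private variable
  A B : Set

-- Counting with finite sums over lists.

𝟙 : Bool → ℕ
𝟙 true  = 1
𝟙 false = 0

∑ : List A → (A → ℕ) → ℕ
∑ []       f = 0
∑ (x ∷ xs) f = f x + ∑ xs f

syntax ∑ xs (λ x → e) = ∑[ x ⟵ xs ] e

select : (A → Bool) → List A → List A
select p = filter (T? ∘ p)

∑-mono : ∀ (xs : List A) {f g} → (∀ {x} → x ∈ xs → f x ≤ g x) → ∑ xs f ≤ ∑ xs g
∑-mono []       h = z≤n
∑-mono (x ∷ xs) h = +-mono-≤ (h (here refl)) (∑-mono xs (h ∘ there))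

∑-cong : ∀ (xs : List A) {f g} → (∀ x → f x ≡ g x) → ∑ xs f ≡ ∑ xs g
∑-cong []       h = refl
∑-cong (x ∷ xs) h = cong₂ _+_ (h x) (∑-cong xs h)

∑-zero : ∀ (xs : List A) → ∑[ x ⟵ xs ] 0 ≡ 0
∑-zero []       = refl
∑-zero (x ∷ xs) = ∑-zero xs

+-interchange : ∀ a b c d → (a + b) + (c + d) ≡ (a + c) + (b + d)
+-interchange = solve-∀

∑-+ : ∀ (xs : List A) f g → ∑[ x ⟵ xs ] (f x + g x) ≡ ∑ xs f + ∑ xs g
∑-+ []       f g = refl
∑-+ (x ∷ xs) f g = trans (cong (f x + g x +_) (∑-+ xs f g))
                         (+-interchange (f x) (g x) (∑ xs f) (∑ xs g))

∑-*ˡ : ∀ (xs : List A) c f → ∑[ x ⟵ xs ] (c * f x) ≡ c * ∑ xs f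
∑-*ˡ []       c f = sym (*-zeroʳ c)
∑-*ˡ (x ∷ xs) c f = trans (cong (c * f x +_) (∑-*ˡ xs c f)) (sym (*-distribˡ-+ c (f x) _))

∑-*ʳ : ∀ (xs : List A) c f → ∑[ x ⟵ xs ] (f x * c) ≡ ∑ xs f * c
∑-*ʳ xs c f = trans (∑-cong xs λ x → *-comm (f x) c) (trans (∑-*ˡ xs c f) (*-comm c _))

∑-const : ∀ (xs : List A) c → ∑[ x ⟵ xs ] c ≡ length xs * c
∑-const []       c = refl
∑-const (x ∷ xs) c = cong (c +_) (∑-const xs c)

∑-≤const : ∀ (xs : List A) c {f} → (∀ {x} → x ∈ xs → f x ≤ c) → ∑ xs f ≤ length xs * c
∑-≤const xs c h = ≤-trans (∑-mono xs h) (≤-reflexive (∑-const xs c))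

∑-swap : ∀ (xs : List A) (ys : List B) (f : A → B → ℕ) →
         ∑[ x ⟵ xs ] ∑[ y ⟵ ys ] f x y ≡ ∑[ y ⟵ ys ] ∑[ x ⟵ xs ] f x y
∑-swap []       ys f = sym (∑-zero ys)
∑-swap (x ∷ xs) ys f = trans (cong (∑ ys (f x) +_) (∑-swap xs ys f)) (sym (∑-+ ys (f x) _))

∑-select : ∀ p (xs : List A) f → ∑ (select p xs) f ≡ ∑[ x ⟵ xs ] (𝟙 (p x) * f x)
∑-select p []       f = refl
∑-select p (x ∷ xs) f with p x
... | true  = cong₂ _+_ (sym (+-identityʳ (f x))) (∑-select p xs f)
... | false = ∑-select p xs f

∑-split : ∀ p (xs : List A) f → ∑ (select p xs) f + ∑ (select (not ∘ p) xs) f ≡ ∑ xs f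
∑-split p []       f = refl
∑-split p (x ∷ xs) f with p x
... | true  = trans (+-assoc (f x) _ _) (cong (f x +_) (∑-split p xs f))
... | false = trans (left-comm (∑ (select p xs) f) (f x) _) (cong (f x +_) (∑-split p xs f))
  where left-comm : ∀ a b c → a + (b + c) ≡ b + (a + c)
        left-comm = solve-∀

∑-select-≤ : ∀ p (xs : List A) f → ∑ (select p xs) f ≤ ∑ xs f
∑-select-≤ p xs f = ≤-trans (m≤m+n _ _) (≤-reflexive (∑-split p xs f))

length-∑ : ∀ (xs : List A) → length xs ≡ ∑[ x ⟵ xs ] 1
length-∑ xs = sym (trans (∑-const xs 1) (*-identityʳ _))

length-select : ∀ p (xs : List A) → length (select p xs) ≡ ∑[ x ⟵ xs ] 𝟙 (p x)
length-select p xs = trans (length-∑ (select p xs))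
  (trans (∑-select p xs _) (∑-cong xs λ x → *-identityʳ _))

length-split : ∀ p (xs : List A) → length (select p xs) + length (select (not ∘ p) xs) ≡ length xs
length-split p xs = trans (cong₂ _+_ (length-∑ (select p xs)) (length-∑ (select (not ∘ p) xs)))
  (trans (∑-split p xs _) (sym (length-∑ xs)))

∑-<⇒∃ : ∀ (xs : List A) {f g} → ∑ xs f < ∑ xs g → ∃ λ x → x ∈ xs × f x < g x
∑-<⇒∃ (x ∷ xs) {f} {g} lt with f x <? g x
... | yes p = x , here refl , p
... | no ¬p with ∑-<⇒∃ xs (+-cancelˡ-< (f x) _ _ (<-≤-trans lt (+-monoˡ-≤ _ (≮⇒≥ ¬p))))
...   | y , y∈ , q = y , there y∈ , q

∑-≤⇒∃ : ∀ (xs : List A) {f g} → 0 < length xs → ∑ xs f ≤ ∑ xs g → ∃ λ x → x ∈ xs × f x ≤ g x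
∑-≤⇒∃ xs {f} {g} 0<n le
  with ∑-<⇒∃ xs {f} {λ x → 1 + g x}
         (≤-trans (s≤s le) (≤-trans (+-monoˡ-≤ _ 0<n)
           (≤-reflexive (sym (trans (∑-+ xs (λ _ → 1) g) (cong (_+ ∑ xs g) (sym (length-∑ xs))))))))
... | x , x∈ , s≤s p = x , x∈ , p

2ab≤a²+b² : ∀ a b → 2 * (a * b) ≤ a * a + b * b
2ab≤a²+b² a b with ≤-total a b
... | inj₁ a≤b = subst (λ b → 2 * (a * b) ≤ a * a + b * b) (m+[n∸m]≡n a≤b)
                   (≤-trans (m≤m+n _ ((b ∸ a) * (b ∸ a))) (≤-reflexive (square a (b ∸ a))))
  where square : ∀ a d → 2 * (a * (a + d)) + d * d ≡ a * a + (a + d) * (a + d)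
        square = solve-∀
... | inj₂ b≤a = subst (λ a → 2 * (a * b) ≤ a * a + b * b) (m+[n∸m]≡n b≤a)
                   (≤-trans (m≤m+n _ ((a ∸ b) * (a ∸ b))) (≤-reflexive (square b (a ∸ b))))
  where square : ∀ b d → 2 * ((b + d) * b) + d * d ≡ (b + d) * (b + d) + b * b
        square = solve-∀

cauchy-schwarz : ∀ (xs : List A) f → ∑ xs f * ∑ xs f ≤ length xs * ∑[ x ⟵ xs ] (f x * f x)
cauchy-schwarz []       f = z≤n
cauchy-schwarz (x ∷ xs) f = begin
  (a + S) * (a + S)                    ≡⟨ expand a S ⟩
  a * a + (2 * (a * S) + S * S)        ≤⟨ +-monoʳ-≤ (a * a) (+-mono-≤ cross (cauchy-schwarz xs f)) ⟩
  a * a + ((n * (a * a) + Q) + n * Q)  ≡⟨ collect a n Q ⟩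
  suc n * (a * a + Q)                  ∎
  where
  open ≤-Reasoning
  a = f x
  S = ∑ xs f
  n = length xs
  Q = ∑[ x ⟵ xs ] (f x * f x)
  expand : ∀ a S → (a + S) * (a + S) ≡ a * a + (2 * (a * S) + S * S)
  expand = solve-∀
  collect : ∀ a n Q → a * a + ((n * (a * a) + Q) + n * Q) ≡ suc n * (a * a + Q)
  collect = solve-∀
  cross : 2 * (a * S) ≤ n * (a * a) + Q
  cross = begin
    2 * (a * S)                        ≡⟨ cong (2 *_) (∑-*ˡ xs a f) ⟨
    2 * ∑[ y ⟵ xs ] (a * f y)          ≡⟨ ∑-*ˡ xs 2 _ ⟨
    ∑[ y ⟵ xs ] (2 * (a * f y))        ≤⟨ ∑-mono xs (λ {y} _ → 2ab≤a²+b² a (f y)) ⟩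
    ∑[ y ⟵ xs ] (a * a + f y * f y)    ≡⟨ ∑-+ xs _ _ ⟩
    ∑[ y ⟵ xs ] (a * a) + Q            ≡⟨ cong (_+ Q) (∑-const xs (a * a)) ⟩
    n * (a * a) + Q                    ∎

∑-at-most-one : ∀ {xs : List A} (p : A → Bool) → Unique xs →
                (∀ {x y} → p x ≡ true → p y ≡ true → x ≡ y) → ∑[ x ⟵ xs ] 𝟙 (p x) ≤ 1
∑-at-most-one p [] h = z≤n
∑-at-most-one {xs = x ∷ xs} p (x∉ ∷ xs!) h with p x in px
... | false = ∑-at-most-one p xs! h
... | true  = s≤s (≤-reflexive (none xs x∉))
  where
  none : ∀ ys → All (x ≢_) ys → ∑[ y ⟵ ys ] 𝟙 (p y) ≡ 0
  none []       []         = refl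
  none (y ∷ ys) (x≢y ∷ ns) with p y in py
  ... | true  = ⊥-elim (x≢y (h px py))
  ... | false = none ys ns

∑≡0⇒∀≡0 : ∀ (ws : List A) {f : A → ℕ} → ∑ ws f ≡ 0 → ∀ {w} → w ∈ ws → f w ≡ 0
∑≡0⇒∀≡0 (w ∷ ws) {f} e (here refl) = m+n≡0⇒m≡0 (f w) e
∑≡0⇒∀≡0 (w ∷ ws) {f} e (there w∈)  = ∑≡0⇒∀≡0 ws (m+n≡0⇒n≡0 (f w) e) w∈

-- An entry with nonzero value contributes at least 1 to the sum. This is how obstructed vertices
-- are counted later.
length≤zeros+∑ : ∀ (xs : List A) (f : A → ℕ) → length xs ≤ length (select (λ x → does (f x ≟ 0)) xs) + ∑ xs f
length≤zeros+∑ xs f = begin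
  length xs                                    ≡⟨ length-∑ xs ⟩
  ∑[ x ⟵ xs ] 1                                ≤⟨ ∑-mono xs (λ {x} _ → one (f x)) ⟩
  ∑[ x ⟵ xs ] (𝟙 (does (f x ≟ 0)) + f x)       ≡⟨ ∑-+ xs _ f ⟩
  ∑[ x ⟵ xs ] 𝟙 (does (f x ≟ 0)) + ∑ xs f      ≡⟨ cong (_+ ∑ xs f) (length-select _ xs) ⟨
  length (select (λ x → does (f x ≟ 0)) xs) + ∑ xs f ∎
  where
  open ≤-Reasoning
  one : ∀ n → 1 ≤ 𝟙 (does (n ≟ 0)) + n
  one zero    = ≤-refl
  one (suc n) = s≤s z≤n

∈⇒≤∑ : ∀ (xs : List A) (f : A → ℕ) {x} → x ∈ xs → f x ≤ ∑ xs f
∈⇒≤∑ (x ∷ xs) f (here refl) = m≤m+n _ _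
∈⇒≤∑ (x ∷ xs) f (there x∈)  = ≤-trans (∈⇒≤∑ xs f x∈) (m≤n+m _ _)

length-allFin : ∀ k → length (allFin k) ≡ k
length-allFin k = length-tabulate id

∑-allFin-suc : ∀ n (f : Fin (suc n) → ℕ) → ∑ (allFin (suc n)) f ≡ f zero + ∑ (allFin n) (f ∘ suc)
∑-allFin-suc n f = cong (f zero +_) (∑-tab n id)
  where
  ∑-tab : ∀ k (g : Fin k → Fin n) → ∑ (tabulate (suc ∘ g)) f ≡ ∑ (tabulate g) (f ∘ suc)
  ∑-tab zero    g = refl
  ∑-tab (suc k) g = cong (f (suc (g zero)) +_) (∑-tab k (g ∘ suc))

∑-++ : ∀ (xs ys : List A) f → ∑ (xs ++ ys) f ≡ ∑ xs f + ∑ ys f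
∑-++ []       ys f = refl
∑-++ (x ∷ xs) ys f = trans (cong (f x +_) (∑-++ xs ys f)) (sym (+-assoc (f x) _ _))

∑-map : ∀ (h : A → B) xs f → ∑ (map h xs) f ≡ ∑ xs (f ∘ h)
∑-map h []       f = refl
∑-map h (x ∷ xs) f = cong (f (h x) +_) (∑-map h xs f)

∑-cartesian : ∀ (xs : List A) (ys : List B) f →
              ∑ (cartesianProduct xs ys) f ≡ ∑[ x ⟵ xs ] ∑[ y ⟵ ys ] f (x , y)
∑-cartesian []       ys f = refl
∑-cartesian (x ∷ xs) ys f = trans (∑-++ (map (x ,_) ys) _ f)
  (cong₂ _+_ (∑-map (x ,_) ys f) (∑-cartesian xs ys f))

𝟙≤1 : ∀ b → 𝟙 b ≤ 1
𝟙≤1 true  = ≤-refl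
𝟙≤1 false = z≤n

T⇒≡ : ∀ {b} → T b → b ≡ true
T⇒≡ {true} _ = refl

∧-true : ∀ {a b} → a ∧ b ≡ true → a ≡ true × b ≡ true
∧-true {true} {true} _ = refl , refl

𝟙-∧ : ∀ a b → 𝟙 (a ∧ b) ≡ 𝟙 a * 𝟙 b
𝟙-∧ true  b = sym (+-identityʳ _)
𝟙-∧ false b = refl

∈-select⁻ : ∀ p (xs : List A) {x} → x ∈ select p xs → x ∈ xs × p x ≡ true
∈-select⁻ p xs x∈ = let a , b = ∈-filter⁻ (T? ∘ p) x∈ in a , T⇒≡ b

does-true : ∀ {P : Set} (P? : Dec P) → does P? ≡ true → P
does-true (yes p) _ = p

𝟙-does-* : ∀ {P : Set} (P? : Dec P) {w r} → (P → w ≤ r) → 𝟙 (does P?) * w ≤ r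
𝟙-does-* (yes p) h = ≤-trans (≤-reflexive (+-identityʳ _)) (h p)
𝟙-does-* (no _)  h = z≤n

𝟙-¬does-* : ∀ {P : Set} (P? : Dec P) {w r} → (¬ P → w ≤ r) → 𝟙 (not (does P?)) * w ≤ r
𝟙-¬does-* (yes _) h = z≤n
𝟙-¬does-* (no ¬p) h = ≤-trans (≤-reflexive (+-identityʳ _)) (h ¬p)

𝟙-yes : ∀ {P : Set} (P? : Dec P) → P → 𝟙 (does P?) ≡ 1
𝟙-yes (yes _) _ = refl
𝟙-yes (no ¬p) p = ⊥-elim (¬p p)

-- The graph on pairs of vertices, and subdivisions in it.

V : ℕ → Set
V m = Fin m × Fin m

Clash : ∀ {m} → V m → V m → Set
Clash a b = (proj₁ a ≡ proj₁ b) ⊎ (proj₂ a ≡ proj₂ b)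

-- What remains of properness in the graph on pairs: at a fixed vertex, either coordinate of a
-- neighbour determines that neighbour. The extremal argument uses nothing else about colours.
record Incidence (m : ℕ) : Set where
  field
    adj    : V m → V m → Bool
    clashʳ : ∀ {x y y′} → adj x y ≡ true → adj x y′ ≡ true → Clash y y′ → y ≡ y′
    clashˡ : ∀ {x x′ y} → adj x y ≡ true → adj x′ y ≡ true → Clash x x′ → x ≡ x′

  -- Branch vertices u and subdivision vertices y of a copy of H_k; the branch (resp. subdivision) vertices have pairwise distinct
  -- first coordinates and pairwise distinct second coordinates.
  record Subdivision (k : ℕ) : Set where
    field
      u        : Fin k → V m
      y        : ∀ i j → i Fin.< j → V m
      used     : List (V m)
      used-len : length used ≤ k * k
      y∈used   : ∀ i j p → y i j p ∈ used
      adj-lo   : ∀ i j p → adj (u i) (y i j p) ≡ true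
      adj-hi   : ∀ i j p → adj (u j) (y i j p) ≡ true
      u-inj    : ∀ i j → Clash (u i) (u j) → i ≡ j
      y-inj    : ∀ i j p i′ j′ p′ → Clash (y i j p) (y i′ j′ p′) → i ≡ i′ × j ≡ j′

  open Subdivision

  clash-sym : ∀ {a b : V m} → Clash a b → Clash b a
  clash-sym (inj₁ p) = inj₁ (sym p)
  clash-sym (inj₂ p) = inj₂ (sym p)

  empty : Subdivision 0
  empty = record
    { u = λ () ; y = λ () ; used = [] ; used-len = z≤n ; y∈used = λ () ; adj-lo = λ ()
    ; adj-hi = λ () ; u-inj = λ () ; y-inj = λ () }

  -- Mere distinctness of `v` from each `u S j` is enough: both are adjacent to `z j`, so by
  -- `clashˡ` a shared coordinate would already make them equal.
  extend : ∀ {k} (S : Subdivision k) v (z : Fin k → V m) →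
           (∀ j → adj v (z j) ≡ true) → (∀ j → adj (u S j) (z j) ≡ true) → (∀ j → v ≢ u S j) →
           (∀ j {w} → w ∈ used S → ¬ Clash (z j) w) → (∀ i j → Clash (z i) (z j) → i ≡ j) →
           Subdivision (suc k)
  extend {k} S v z vz uz v≢u fresh z-inj = record
    { u = u′ ; y = y′ ; used = tabulate z ++ used S ; used-len = len ; y∈used = y′∈
    ; adj-lo = lo′ ; adj-hi = hi′ ; u-inj = u′-inj ; y-inj = y′-inj }
    where
    u′ : Fin (suc k) → V m
    u′ zero    = v
    u′ (suc i) = u S i
    y′ : ∀ i j → i Fin.< j → V m
    y′ zero    (suc j) p       = z j
    y′ (suc i) (suc j) (s≤s p) = y S i j p
    len : length (tabulate z ++ used S) ≤ suc k * suc k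
    len = begin
      length (tabulate z ++ used S)        ≡⟨ length-++ (tabulate z) ⟩
      length (tabulate z) + length (used S) ≡⟨ cong (_+ length (used S)) (length-tabulate z) ⟩
      k + length (used S)                  ≤⟨ +-monoʳ-≤ k (used-len S) ⟩
      k + k * k                            ≤⟨ m≤n+m _ (suc k) ⟩
      suc k + (k + k * k)                  ≡⟨ cong (suc k +_) (*-suc k k) ⟨
      suc k * suc k                        ∎
      where open ≤-Reasoning
    y′∈ : ∀ i j p → y′ i j p ∈ tabulate z ++ used S
    y′∈ zero    (suc j) p       = ∈-++⁺ˡ (∈-tabulate⁺ j)
    y′∈ (suc i) (suc j) (s≤s p) = ∈-++⁺ʳ (tabulate z) (y∈used S i j p)
    lo′ : ∀ i j p → adj (u′ i) (y′ i j p) ≡ true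
    lo′ zero    (suc j) p       = vz j
    lo′ (suc i) (suc j) (s≤s p) = adj-lo S i j p
    hi′ : ∀ i j p → adj (u′ j) (y′ i j p) ≡ true
    hi′ zero    (suc j) p       = uz j
    hi′ (suc i) (suc j) (s≤s p) = adj-hi S i j p
    u′-inj : ∀ i j → Clash (u′ i) (u′ j) → i ≡ j
    u′-inj zero    zero    c = refl
    u′-inj zero    (suc j) c = ⊥-elim (v≢u j (clashˡ (vz j) (uz j) c))
    u′-inj (suc i) zero    c = ⊥-elim (v≢u i (clashˡ (vz i) (uz i) (clash-sym c)))
    u′-inj (suc i) (suc j) c = cong suc (u-inj S i j c)
    y′-inj : ∀ i j p i′ j′ p′ → Clash (y′ i j p) (y′ i′ j′ p′) → i ≡ i′ × j ≡ j′
    y′-inj zero    (suc j) p       zero     (suc j′) p′       c = refl , cong suc (z-inj j j′ c)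
    y′-inj zero    (suc j) p       (suc i′) (suc j′) (s≤s p′) c = ⊥-elim (fresh j (y∈used S i′ j′ p′) c)
    y′-inj (suc i) (suc j) (s≤s p) zero     (suc j′) p′       c = ⊥-elim (fresh j′ (y∈used S i j p) (clash-sym c))
    y′-inj (suc i) (suc j) (s≤s p) (suc i′) (suc j′) (s≤s p′) c =
      let a , b = y-inj S i j p i′ j′ p′ c in cong suc a , cong suc b

  infix 4 _≟ⱽ_
  _≟ⱽ_ = ≡-dec (_≟ᶠ_ {m}) (_≟ᶠ_ {m})

  -- A numerical form of `Clash`, so that clashes with a whole list can be bounded by exchanging
  -- sums.
  share : V m → V m → ℕ
  share a b = 𝟙 (does (proj₁ a ≟ᶠ proj₁ b)) + 𝟙 (does (proj₂ a ≟ᶠ proj₂ b))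

  share≡0⇒¬Clash : ∀ {a b} → share a b ≡ 0 → ¬ Clash a b
  share≡0⇒¬Clash {a} {b} eq c with proj₁ a ≟ᶠ proj₁ b | proj₂ a ≟ᶠ proj₂ b
  share≡0⇒¬Clash () c        | yes _ | _
  share≡0⇒¬Clash () c        | no  _ | yes _
  share≡0⇒¬Clash eq (inj₁ e) | no ¬p | no _  = ¬p e
  share≡0⇒¬Clash eq (inj₂ e) | no _  | no ¬q = ¬q e

-- Heavy and light pairs in a graph without a subdivision.

max-obstruction : ℕ → ℕ → ℕ
max-obstruction t s = t * (t * s) + t * (t * t * 2)

max-obstruction-pos : ∀ t s → 0 < t → 0 < s → 0 < max-obstruction t s
max-obstruction-pos t s 0<t 0<s = ≤-trans (*-mono-≤ 0<t (*-mono-≤ 0<t 0<s)) (m≤m+n _ _)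

degree : ∀ {m} → Incidence m → List (V m) → V m → ℕ
degree I Y x = ∑[ y ⟵ Y ] 𝟙 (Incidence.adj I x y)

module LinkedPairs
  {m} (I : Incidence m) (Y : List (V m)) (Y! : Unique Y) (t s : ℕ) (2t²≤s : t * t * 2 ≤ s)
  (0<t : 0 < t) (none : ¬ Incidence.Subdivision I t) where
  open Incidence I
  open Subdivision

  deg : V m → ℕ
  deg = degree I Y

  codeg : V m → V m → ℕ
  codeg a b = ∑[ y ⟵ Y ] (𝟙 (adj a y) * 𝟙 (adj b y))

  -- By `clashʳ` at most one neighbour of `x` agrees with `w` in the first coordinate, and at most
  -- one in the second.
  share-bound : ∀ x w → ∑[ y ⟵ Y ] (𝟙 (adj x y) * share y w) ≤ 2
  share-bound x w = begin
    ∑[ y ⟵ Y ] (𝟙 (adj x y) * share y w)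
      ≡⟨ ∑-cong Y (λ y → trans (*-distribˡ-+ (𝟙 (adj x y)) _ _) (sym (cong₂ _+_ (𝟙-∧ (adj x y) _) (𝟙-∧ (adj x y) _)))) ⟩
    ∑[ y ⟵ Y ] (𝟙 (adj x y ∧ does (proj₁ y ≟ᶠ proj₁ w)) + 𝟙 (adj x y ∧ does (proj₂ y ≟ᶠ proj₂ w)))
      ≡⟨ ∑-+ Y _ _ ⟩
    ∑[ y ⟵ Y ] 𝟙 (adj x y ∧ does (proj₁ y ≟ᶠ proj₁ w)) + ∑[ y ⟵ Y ] 𝟙 (adj x y ∧ does (proj₂ y ≟ᶠ proj₂ w))
      ≤⟨ +-mono-≤
           (∑-at-most-one _ Y! λ e e′ → clashʳ (proj₁ (∧-true e)) (proj₁ (∧-true e′)) (inj₁ (meet₁ e e′)))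
           (∑-at-most-one _ Y! λ e e′ → clashʳ (proj₁ (∧-true e)) (proj₁ (∧-true e′)) (inj₂ (meet₂ e e′))) ⟩
    2 ∎
    where
    open ≤-Reasoning
    meet₁ : ∀ {y y′} → adj x y ∧ does (proj₁ y ≟ᶠ proj₁ w) ≡ true → adj x y′ ∧ does (proj₁ y′ ≟ᶠ proj₁ w) ≡ true →
            proj₁ y ≡ proj₁ y′
    meet₁ {y} {y′} e e′ = trans (does-true (proj₁ y ≟ᶠ proj₁ w) (proj₂ (∧-true {adj x y} e)))
      (sym (does-true (proj₁ y′ ≟ᶠ proj₁ w) (proj₂ (∧-true {adj x y′} e′))))
    meet₂ : ∀ {y y′} → adj x y ∧ does (proj₂ y ≟ᶠ proj₂ w) ≡ true → adj x y′ ∧ does (proj₂ y′ ≟ᶠ proj₂ w) ≡ true →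
            proj₂ y ≡ proj₂ y′
    meet₂ {y} {y′} e e′ = trans (does-true (proj₂ y ≟ᶠ proj₂ w) (proj₂ (∧-true {adj x y} e)))
      (sym (does-true (proj₂ y′ ≟ᶠ proj₂ w) (proj₂ (∧-true {adj x y′} e′))))

  shares-bound : ∀ x ws → ∑[ y ⟵ Y ] (𝟙 (adj x y) * ∑[ w ⟵ ws ] share y w) ≤ length ws * 2
  shares-bound x ws = begin
    ∑[ y ⟵ Y ] (𝟙 (adj x y) * ∑[ w ⟵ ws ] share y w)
      ≡⟨ ∑-cong Y (λ y → sym (∑-*ˡ ws (𝟙 (adj x y)) (share y))) ⟩
    ∑[ y ⟵ Y ] ∑[ w ⟵ ws ] (𝟙 (adj x y) * share y w)
      ≡⟨ ∑-swap Y ws _ ⟩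
    ∑[ w ⟵ ws ] ∑[ y ⟵ Y ] (𝟙 (adj x y) * share y w)
      ≤⟨ ∑-≤const ws 2 (λ {w} _ → share-bound x w) ⟩
    length ws * 2 ∎
    where open ≤-Reasoning

  -- Clashes with `ws` among the neighbours of `v` total at most `length ws * 2`, less than the
  -- number of common neighbours. So some `z` contributes less to the former sum than to the latter,
  -- which forces both adjacencies and no clash.
  fresh-neighbour : ∀ v x ws → length ws * 2 < codeg v x →
    ∃ λ z → adj v z ≡ true × adj x z ≡ true × (∀ {w} → w ∈ ws → ¬ Clash z w)
  fresh-neighbour v x ws lt
    with ∑-<⇒∃ Y (≤-<-trans (shares-bound v ws) lt)
  ... | z , _ , q with adj v z in vz | adj x z in xz
  ...   | true | true with ∑ ws (share z) in eq | q
  ...     | zero  | _ = z , vz , xz , λ w∈ → share≡0⇒¬Clash (∑≡0⇒∀≡0 ws eq w∈)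
  ...     | suc _ | s≤s ()
  fresh-neighbour v x ws lt | z , _ , () | true | false
  fresh-neighbour v x ws lt | z , _ , () | false | _

  -- Heavy pairs keep a common neighbour however the other subdivision vertices are chosen.
  heavy : V m → V m → Bool
  heavy a b = does (¬? (a ≟ⱽ b) ×-dec (s ≤? codeg a b))

  heavy⇒ : ∀ a b → heavy a b ≡ true → a ≢ b × s ≤ codeg a b
  heavy⇒ a b = does-true (¬? (a ≟ⱽ b) ×-dec (s ≤? codeg a b))

  -- Each chosen vertex joins the list to be avoided, so the budget `(length ws + k) * 2` is the
  -- same at every step.
  fresh-neighbours : ∀ k (x : Fin k → V m) v ws → (∀ j → s ≤ codeg v (x j)) → (length ws + k) * 2 ≤ s →
    ∃ λ (z : Fin k → V m) → (∀ j → adj v (z j) ≡ true) × (∀ j → adj (x j) (z j) ≡ true) ×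
      (∀ j {w} → w ∈ ws → ¬ Clash (z j) w) × (∀ i j → Clash (z i) (z j) → i ≡ j)
  fresh-neighbours zero    x v ws h le = (λ ()) , (λ ()) , (λ ()) , (λ ()) , (λ ())
  fresh-neighbours (suc k) x v ws h le
    with fresh-neighbour v (x zero) ws
           (<-≤-trans (*-monoˡ-< 2 (m<m+n (length ws) z<s)) (≤-trans le (h zero)))
  ... | z₀ , vz₀ , xz₀ , fr₀
    with fresh-neighbours k (x ∘ suc) v (z₀ ∷ ws) (h ∘ suc)
           (≤-trans (≤-reflexive (cong (_* 2) (sym (+-suc (length ws) k)))) le)
  ... | z , vz , xz , fr , inj = z′ , vz′ , xz′ , fr′ , inj′
    where
    z′ : Fin (suc k) → V m
    z′ zero    = z₀
    z′ (suc j) = z j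
    vz′ : ∀ j → adj v (z′ j) ≡ true
    vz′ zero    = vz₀
    vz′ (suc j) = vz j
    xz′ : ∀ j → adj (x j) (z′ j) ≡ true
    xz′ zero    = xz₀
    xz′ (suc j) = xz j
    fr′ : ∀ j {w} → w ∈ ws → ¬ Clash (z′ j) w
    fr′ zero    w∈ = fr₀ w∈
    fr′ (suc j) w∈ = fr j (there w∈)
    inj′ : ∀ i j → Clash (z′ i) (z′ j) → i ≡ j
    inj′ zero    zero    c = refl
    inj′ zero    (suc j) c = ⊥-elim (fr j (here refl) (clash-sym c))
    inj′ (suc i) zero    c = ⊥-elim (fr i (here refl) c)
    inj′ (suc i) (suc j) c = cong suc (inj i j c)

  -- A greedy Turán argument: keeping only the heavy partners of the head of `W` loses at most w / a
  -- entries, so k rounds are possible. The factor `a` avoids a division. No vertex is heavy to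
  -- itself, so repetitions in `W` do no harm.
  heavy-clique : ∀ k W a w → k ≤ t →
    (∀ {v} → v ∈ W → a * ∑[ b ⟵ W ] 𝟙 (not (heavy v b)) ≤ w) → k * w < a * length W →
    Σ (Subdivision k) λ S → ∀ i → u S i ∈ W
  heavy-clique zero    W        a w k≤t few lt = empty , λ ()
  heavy-clique (suc k) []       a w k≤t few lt = ⊥-elim (n≮0 (subst (suc k * w <_) (*-zeroʳ a) lt))
  heavy-clique (suc k) W@(v ∷ _) a w k<t few lt
    with heavy-clique k (select (heavy v) W) a w (<⇒≤ k<t)
           (λ {b} b∈ → ≤-trans (*-monoʳ-≤ a (∑-select-≤ (heavy v) W _)) (few (proj₁ (∈-select⁻ (heavy v) W b∈))))
           (+-cancelˡ-< w _ _ (<-≤-trans lt size))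
    where
    open ≤-Reasoning
    size : a * length W ≤ w + a * length (select (heavy v) W)
    size = begin
      a * length W
        ≡⟨ cong (a *_) (length-split (heavy v) W) ⟨
      a * (length (select (heavy v) W) + length (select (not ∘ heavy v) W))
        ≡⟨ *-distribˡ-+ a (length (select (heavy v) W)) _ ⟩
      a * length (select (heavy v) W) + a * length (select (not ∘ heavy v) W)
        ≡⟨ cong (λ l → a * length (select (heavy v) W) + a * l) (length-select (not ∘ heavy v) W) ⟩
      a * length (select (heavy v) W) + a * ∑[ b ⟵ W ] 𝟙 (not (heavy v b))
        ≤⟨ +-monoʳ-≤ _ (few (here refl)) ⟩
      a * length (select (heavy v) W) + w
        ≡⟨ +-comm _ w ⟩
      w + a * length (select (heavy v) W) ∎
  ... | S , S∈
    with fresh-neighbours k (u S) v (used S) (λ j → proj₂ (hv j)) bound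
    where
    hv : ∀ j → v ≢ u S j × s ≤ codeg v (u S j)
    hv j = heavy⇒ v (u S j) (proj₂ (∈-select⁻ (heavy v) W (S∈ j)))
    -- At most k² vertices are used and k are new, together at most t²; each excludes two
    -- candidates. Hence the threshold 2t² for heaviness.
    bound : (length (used S) + k) * 2 ≤ s
    bound = ≤-trans (*-monoˡ-≤ 2 (≤-trans (+-monoˡ-≤ k (used-len S))
              (≤-trans (≤-reflexive (trans (+-comm _ k) (sym (*-suc k k)))) (*-mono-≤ (<⇒≤ k<t) k<t)))) 2t²≤s
  ... | z , vz , xz , fr , inj = extend S v z vz xz
          (λ j → proj₁ (heavy⇒ v (u S j) (proj₂ (∈-select⁻ (heavy v) W (S∈ j))))) fr inj , mem
    where
    mem : ∀ i → u (extend S v z vz xz (λ j → proj₁ (heavy⇒ v (u S j) (proj₂ (∈-select⁻ (heavy v) W (S∈ j))))) fr inj) i ∈ W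
    mem zero    = here refl
    mem (suc i) = proj₁ (∈-select⁻ (heavy v) W (S∈ i))

  -- Otherwise more than half of `W` would be thin, that is, non-heavy to at most a fraction 1 /
  -- (2t) of `W`, and `heavy-clique` among the thin vertices would build the excluded subdivision.
  nonheavy-pairs : ∀ W → length W * length W ≤ 4 * t * ∑[ a ⟵ W ] ∑[ b ⟵ W ] 𝟙 (not (heavy a b))
  nonheavy-pairs W with length W * length W ≤? 4 * t * ∑[ a ⟵ W ] ∑[ b ⟵ W ] 𝟙 (not (heavy a b))
  ... | yes p = p
  ... | no ¬p = ⊥-elim (none (proj₁ (heavy-clique t (select thin W) (2 * t) w ≤-refl few large)))
    where
    open ≤-Reasoning
    w = length W
    ld : V m → ℕ
    ld a = ∑[ b ⟵ W ] 𝟙 (not (heavy a b))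
    thin : V m → Bool
    thin a = does (2 * t * ld a ≤? w)
    thin⇒ : ∀ {a} → thin a ≡ true → 2 * t * ld a ≤ w
    thin⇒ {a} = does-true (2 * t * ld a ≤? w)
    few : ∀ {a} → a ∈ select thin W → 2 * t * ∑[ b ⟵ select thin W ] 𝟙 (not (heavy a b)) ≤ w
    few a∈ = ≤-trans (*-monoʳ-≤ (2 * t) (∑-select-≤ thin W _)) (thin⇒ (proj₂ (∈-select⁻ thin W a∈)))
    fat-bound : ∀ a → 𝟙 (not (thin a)) * w ≤ 2 * t * ld a
    fat-bound a = 𝟙-¬does-* (2 * t * ld a ≤? w) (<⇒≤ ∘ ≰⇒>)
    fat = length (select (not ∘ thin) W)
    fat*w : 2 * fat * w < w * w
    fat*w = begin-strict
      2 * fat * w                                 ≡⟨ *-assoc 2 fat w ⟩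
      2 * (fat * w)                               ≡⟨ cong (λ l → 2 * (l * w)) (length-select (not ∘ thin) W) ⟩
      2 * (∑[ a ⟵ W ] 𝟙 (not (thin a)) * w)       ≡⟨ cong (2 *_) (∑-*ʳ W w _) ⟨
      2 * ∑[ a ⟵ W ] (𝟙 (not (thin a)) * w)       ≤⟨ *-monoʳ-≤ 2 (∑-mono W λ {a} _ → fat-bound a) ⟩
      2 * ∑[ a ⟵ W ] (2 * t * ld a)               ≡⟨ cong (2 *_) (∑-*ˡ W (2 * t) ld) ⟩
      2 * (2 * t * ∑ W ld)                        ≡⟨ assoc-double t (∑ W ld) ⟩
      4 * t * ∑ W ld                              <⟨ ≰⇒> ¬p ⟩
      w * w                                       ∎
      where assoc-double : ∀ t x → 2 * (2 * t * x) ≡ 4 * t * x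
            assoc-double = solve-∀
    thin-large : w < 2 * length (select thin W)
    thin-large = +-cancelʳ-< (2 * fat) _ _ (begin-strict
      w + 2 * fat                                 <⟨ +-monoʳ-< w (*-cancelʳ-< w (2 * fat) w fat*w) ⟩
      w + w                                       ≡⟨ cong (w +_) (+-identityʳ w) ⟨
      2 * w                                       ≡⟨ cong (2 *_) (length-split thin W) ⟨
      2 * (length (select thin W) + fat)          ≡⟨ *-distribˡ-+ 2 (length (select thin W)) fat ⟩
      2 * length (select thin W) + 2 * fat        ∎)
    large : t * w < 2 * t * length (select thin W)
    large = begin-strict
      t * w                                       <⟨ *-monoʳ-< t {{>-nonZero 0<t}} thin-large ⟩
      t * (2 * length (select thin W))            ≡⟨ commute t (length (select thin W)) ⟩
      2 * t * length (select thin W)              ∎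
      where commute : ∀ t x → t * (2 * x) ≡ 2 * t * x
            commute = solve-∀

  -- The light pairs of use: a positive codegree is demanded because the two vertices are to be
  -- joined through a common neighbour.
  link : V m → V m → Bool
  link a b = does (¬? (a ≟ⱽ b) ×-dec (codeg a b <? s) ×-dec (0 <? codeg a b))

  link⇒ : ∀ a b → link a b ≡ true → a ≢ b × codeg a b < s × 0 < codeg a b
  link⇒ a b = does-true (¬? (a ≟ⱽ b) ×-dec (codeg a b <? s) ×-dec (0 <? codeg a b))

  codeg≤deg : ∀ a b → codeg a b ≤ deg a
  codeg≤deg a b = ∑-mono Y λ {y} _ →
    ≤-trans (*-monoʳ-≤ (𝟙 (adj a y)) (𝟙≤1 (adj b y))) (≤-reflexive (*-identityʳ _))

  nonheavy-codeg : ∀ a b →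
    𝟙 (not (heavy a b)) * codeg a b ≤ s * 𝟙 (link a b) + 𝟙 (does (a ≟ⱽ b)) * deg a
  nonheavy-codeg a b = 𝟙-¬does-* (¬? (a ≟ⱽ b) ×-dec (s ≤? codeg a b)) λ ¬h →
    bound ¬h (a ≟ⱽ b) (0 <? codeg a b)
    where
    open ≤-Reasoning
    bound : ¬ (a ≢ b × s ≤ codeg a b) → Dec (a ≡ b) → Dec (0 < codeg a b) →
            codeg a b ≤ s * 𝟙 (link a b) + 𝟙 (does (a ≟ⱽ b)) * deg a
    bound ¬h (yes a≡b) _ = begin
      codeg a b                           ≤⟨ codeg≤deg a b ⟩
      deg a                               ≡⟨ +-identityʳ _ ⟨
      1 * deg a                           ≡⟨ cong (_* deg a) (𝟙-yes (a ≟ⱽ b) a≡b) ⟨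
      𝟙 (does (a ≟ⱽ b)) * deg a           ≤⟨ m≤n+m _ _ ⟩
      s * 𝟙 (link a b) + 𝟙 (does (a ≟ⱽ b)) * deg a ∎
    bound ¬h (no a≢b) (no ¬pos) = ≤-trans (≮⇒≥ ¬pos) z≤n
    bound ¬h (no a≢b) (yes pos) = begin
      codeg a b                           ≤⟨ <⇒≤ small ⟩
      s                                   ≡⟨ *-identityʳ s ⟨
      s * 1                               ≡⟨ cong (s *_) (𝟙-yes (¬? (a ≟ⱽ b) ×-dec (codeg a b <? s) ×-dec (0 <? codeg a b)) (a≢b , small , pos)) ⟨
      s * 𝟙 (link a b)                    ≤⟨ m≤m+n _ _ ⟩
      s * 𝟙 (link a b) + 𝟙 (does (a ≟ⱽ b)) * deg a ∎
      where
      small : codeg a b < s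
      small = ≰⇒> λ le → ¬h (a≢b , le)

  links : List (V m) → V m → ℕ
  links U a = length (select (link a) U)

  -- A double count of paths a - y - b with both ends in `U`. Cauchy-Schwarz over `Y` and
  -- `nonheavy-pairs` in each neighbourhood leave only paths with non-heavy ends. Regrouped by their
  -- ends, a linked pair carries fewer than `s` of them, and the diagonal gives back the edges.
  cherries : ∀ U → Unique U → ∑ U deg * ∑ U deg ≤ length Y * (4 * t * (s * ∑ U (links U) + ∑ U deg))
  cherries U U! = begin
    ∑ U deg * ∑ U deg               ≡⟨ cong₂ _*_ (∑-swap U Y _) (∑-swap U Y _) ⟩
    ∑ Y w * ∑ Y w                   ≤⟨ cauchy-schwarz Y w ⟩
    length Y * ∑[ y ⟵ Y ] (w y * w y)
      ≤⟨ *-monoʳ-≤ (length Y) (∑-mono Y λ {y} _ → turan y) ⟩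
    length Y * ∑[ y ⟵ Y ] (4 * t * ∑[ a ⟵ U ] ∑[ b ⟵ U ] (nh a b * (𝟙 (adj a y) * 𝟙 (adj b y))))
      ≡⟨ cong (length Y *_) (∑-*ˡ Y (4 * t) _) ⟩
    length Y * (4 * t * ∑[ y ⟵ Y ] ∑[ a ⟵ U ] ∑[ b ⟵ U ] (nh a b * (𝟙 (adj a y) * 𝟙 (adj b y))))
      ≡⟨ cong (λ z → length Y * (4 * t * z)) collect ⟩
    length Y * (4 * t * ∑[ a ⟵ U ] ∑[ b ⟵ U ] (nh a b * codeg a b))
      ≤⟨ *-monoʳ-≤ (length Y) (*-monoʳ-≤ (4 * t) (∑-mono U λ {a} _ → row a)) ⟩
    length Y * (4 * t * ∑[ a ⟵ U ] (s * links U a + deg a))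
      ≡⟨ cong (λ z → length Y * (4 * t * z)) (trans (∑-+ U _ deg) (cong (_+ ∑ U deg) (∑-*ˡ U s _))) ⟩
    length Y * (4 * t * (s * ∑ U (links U) + ∑ U deg)) ∎
    where
    open ≤-Reasoning
    w : V m → ℕ
    w y = ∑[ a ⟵ U ] 𝟙 (adj a y)
    nh : V m → V m → ℕ
    nh a b = 𝟙 (not (heavy a b))
    turan : ∀ y → w y * w y ≤ 4 * t * ∑[ a ⟵ U ] ∑[ b ⟵ U ] (nh a b * (𝟙 (adj a y) * 𝟙 (adj b y)))
    turan y = begin
      w y * w y                     ≡⟨ cong₂ _*_ (length-select N U) (length-select N U) ⟨
      length W * length W           ≤⟨ nonheavy-pairs W ⟩
      4 * t * ∑[ a ⟵ W ] ∑[ b ⟵ W ] nh a b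
        ≡⟨ cong (4 * t *_) (∑-select N U _) ⟩
      4 * t * ∑[ a ⟵ U ] (𝟙 (N a) * ∑[ b ⟵ W ] nh a b)
        ≡⟨ cong (4 * t *_) (∑-cong U λ a → trans (cong (𝟙 (N a) *_) (∑-select N U _))
             (trans (sym (∑-*ˡ U (𝟙 (N a)) _)) (∑-cong U λ b → rotate (𝟙 (N a)) (𝟙 (N b)) (nh a b)))) ⟩
      4 * t * ∑[ a ⟵ U ] ∑[ b ⟵ U ] (nh a b * (𝟙 (N a) * 𝟙 (N b))) ∎
      where
      N : V m → Bool
      N a = adj a y
      W = select N U
      rotate : ∀ p q r → p * (q * r) ≡ r * (p * q)
      rotate = solve-∀
    collect : ∑[ y ⟵ Y ] ∑[ a ⟵ U ] ∑[ b ⟵ U ] (nh a b * (𝟙 (adj a y) * 𝟙 (adj b y)))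
            ≡ ∑[ a ⟵ U ] ∑[ b ⟵ U ] (nh a b * codeg a b)
    collect = trans (∑-swap Y U _) (∑-cong U λ a → trans (∑-swap Y U _) (∑-cong U λ b → ∑-*ˡ Y (nh a b) _))
    row : ∀ a → ∑[ b ⟵ U ] (nh a b * codeg a b) ≤ s * links U a + deg a
    row a = begin
      ∑[ b ⟵ U ] (nh a b * codeg a b)
        ≤⟨ ∑-mono U (λ {b} _ → nonheavy-codeg a b) ⟩
      ∑[ b ⟵ U ] (s * 𝟙 (link a b) + 𝟙 (does (a ≟ⱽ b)) * deg a)
        ≡⟨ ∑-+ U _ _ ⟩
      ∑[ b ⟵ U ] (s * 𝟙 (link a b)) + ∑[ b ⟵ U ] (𝟙 (does (a ≟ⱽ b)) * deg a)
        ≡⟨ cong₂ _+_ (trans (∑-*ˡ U s _) (cong (s *_) (sym (length-select (link a) U)))) (∑-*ʳ U (deg a) _) ⟩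
      s * links U a + ∑[ b ⟵ U ] 𝟙 (does (a ≟ⱽ b)) * deg a
        ≤⟨ +-monoʳ-≤ _ (*-monoˡ-≤ (deg a) (∑-at-most-one (λ b → does (a ≟ⱽ b)) U!
             λ e e′ → trans (sym (does-true (a ≟ⱽ _) e)) (does-true (a ≟ⱽ _) e′))) ⟩
      s * links U a + 1 * deg a ≡⟨ cong (s * links U a +_) (+-identityʳ _) ⟩
      s * links U a + deg a ∎

  -- With at least 8tM edges the diagonal term of `cherries` is at most half of the square and is
  -- absorbed. The averaging is weighted by degree, so that the minimal degree can be applied to the
  -- chosen `v`.
  linked-vertex : ∀ M U → Unique U → length Y ≤ M → 8 * t * M ≤ ∑ U deg → 0 < ∑ U deg →
    ∃ λ v → v ∈ U × deg v * ∑ U deg ≤ 8 * t * M * s * links U v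
  linked-vertex M U U! Y≤M large pos = ∑-≤⇒∃ U (0<len U pos) (begin
    ∑[ v ⟵ U ] (deg v * e)                  ≡⟨ ∑-*ʳ U e deg ⟩
    e * e                                   ≤⟨ +-cancelʳ-≤ (e * e) _ _ double ⟩
    8 * t * M * s * ∑ U (links U)           ≡⟨ ∑-*ˡ U (8 * t * M * s) _ ⟨
    ∑[ v ⟵ U ] (8 * t * M * s * links U v)  ∎)
    where
    open ≤-Reasoning
    e = ∑ U deg
    Λ = ∑ U (links U)
    0<len : ∀ U → 0 < ∑ U deg → 0 < length U
    0<len (_ ∷ _) _ = z<s
    regroup : ∀ t M s Λ e → 2 * (M * (4 * t * (s * Λ + e))) ≡ 8 * t * M * s * Λ + 8 * t * M * e
    regroup = solve-∀
    double : e * e + e * e ≤ 8 * t * M * s * Λ + e * e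
    double = begin
      e * e + e * e                          ≡⟨ cong (e * e +_) (+-identityʳ (e * e)) ⟨
      2 * (e * e)                            ≤⟨ *-monoʳ-≤ 2 (cherries U U!) ⟩
      2 * (length Y * (4 * t * (s * Λ + e))) ≤⟨ *-monoʳ-≤ 2 (*-monoˡ-≤ (4 * t * (s * Λ + e)) Y≤M) ⟩
      2 * (M * (4 * t * (s * Λ + e)))        ≡⟨ regroup t M s Λ e ⟩
      8 * t * M * s * Λ + 8 * t * M * e      ≤⟨ +-monoʳ-≤ _ (*-monoˡ-≤ e large) ⟩
      8 * t * M * s * Λ + e * e              ∎

  -- Vertices that would make subdivision vertices clash.

  codeg-comm : ∀ a b → codeg a b ≡ codeg b a
  codeg-comm a b = ∑-cong Y λ y → *-comm (𝟙 (adj a y)) _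

  distinct : ∀ {k} → Fin k → Fin k → ℕ
  distinct i j = 𝟙 (not (does (i ≟ᶠ j)))

  distinct≡1 : ∀ {k} {i j : Fin k} → i ≢ j → distinct i j ≡ 1
  distinct≡1 {i = i} {j} i≢j with i ≟ᶠ j
  ... | yes e = ⊥-elim (i≢j e)
  ... | no _  = refl

  -- A vertex v avoiding every y of positive weight can be joined to S by arbitrary
  -- choices of common neighbours: two choices clash only if they coincide, since both
  -- are adjacent to v.
  weight : ∀ {k} → Subdivision k → V m → ℕ
  weight {k} S y =
    ∑[ i ⟵ allFin k ] ∑[ j ⟵ allFin k ] (distinct i j * (𝟙 (adj (u S i) y) * 𝟙 (adj (u S j) y))) +
    ∑[ i ⟵ allFin k ] (𝟙 (adj (u S i) y) * ∑ (used S) (share y))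

  obstruction : ∀ {k} → Subdivision k → V m → ℕ
  obstruction S v = ∑[ y ⟵ Y ] (weight S y * 𝟙 (adj v y))

  R : ℕ
  R = max-obstruction t s

  -- The two summands of `R`: at most t² pairs of branch vertices with at most `s` common neighbours
  -- each, and t branch vertices, each having at most two neighbours that meet a given one of the at
  -- most t² used vertices. The bound does not depend on `m`.
  ∑-weight : ∀ {k} (S : Subdivision k) → k ≤ t → (∀ i j → i ≢ j → codeg (u S i) (u S j) < s) →
             ∑ Y (weight S) ≤ R
  ∑-weight {k} S k≤t light = begin
    ∑ Y (weight S)
      ≡⟨ ∑-+ Y _ _ ⟩
    ∑[ y ⟵ Y ] ∑[ i ⟵ F ] ∑[ j ⟵ F ] pair i j y + ∑[ y ⟵ Y ] ∑[ i ⟵ F ] (𝟙 (adj (u S i) y) * ∑ (used S) (share y))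
      ≡⟨ cong₂ _+_ (trans (∑-swap Y F _) (∑-cong F λ i → ∑-swap Y F _)) (∑-swap Y F _) ⟩
    ∑[ i ⟵ F ] ∑[ j ⟵ F ] ∑[ y ⟵ Y ] pair i j y + ∑[ i ⟵ F ] ∑[ y ⟵ Y ] (𝟙 (adj (u S i) y) * ∑ (used S) (share y))
      ≤⟨ +-mono-≤ (∑-≤const F (t * s) λ {i} _ → ≤-trans (∑-≤const F s λ {j} _ → pair-bound i j) (k*≤ s))
                  (∑-≤const F (t * t * 2) λ {i} _ → ≤-trans (shares-bound (u S i) (used S))
                     (*-monoˡ-≤ 2 (≤-trans (used-len S) (*-mono-≤ k≤t k≤t)))) ⟩
    length F * (t * s) + length F * (t * t * 2)
      ≤⟨ +-mono-≤ (k*≤ (t * s)) (k*≤ (t * t * 2)) ⟩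
    R ∎
    where
    open ≤-Reasoning
    F = allFin k
    k*≤ : ∀ c → length F * c ≤ t * c
    k*≤ c = *-monoˡ-≤ c (≤-trans (≤-reflexive (length-allFin k)) k≤t)
    pair : Fin k → Fin k → V m → ℕ
    pair i j y = distinct i j * (𝟙 (adj (u S i) y) * 𝟙 (adj (u S j) y))
    pair-bound : ∀ i j → ∑ Y (pair i j) ≤ s
    pair-bound i j = ≤-trans (≤-reflexive (∑-*ˡ Y (distinct i j) _))
      (𝟙-¬does-* (i ≟ᶠ j) λ i≢j → <⇒≤ (light i j i≢j))

  common-neighbour : ∀ a b → 0 < codeg a b → ∃ λ y → y ∈ Y × adj a y ≡ true × adj b y ≡ true
  common-neighbour a b pos with ∑-<⇒∃ Y {λ _ → 0} (subst (_< codeg a b) (sym (∑-zero Y)) pos)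
  ... | y , y∈ , q with adj a y in ay | adj b y in by
  ...   | true | true = y , y∈ , ay , by

  module _ {k} (S : Subdivision k) v (linked : ∀ j → link (u S j) v ≡ true) (clear : obstruction S v ≡ 0) where

    private
      F = allFin k

      nb : ∀ j → ∃ λ y → y ∈ Y × adj (u S j) y ≡ true × adj v y ≡ true
      nb j = common-neighbour (u S j) v (proj₂ (proj₂ (link⇒ (u S j) v (linked j))))

      z : Fin k → V m
      z = proj₁ ∘ nb

      uz : ∀ j → adj (u S j) (z j) ≡ true
      uz j = proj₁ (proj₂ (proj₂ (nb j)))

      vz : ∀ j → adj v (z j) ≡ true
      vz j = proj₂ (proj₂ (proj₂ (nb j)))

      weight≡0 : ∀ j → weight S (z j) ≡ 0
      weight≡0 j = trans (sym (*-identityʳ _)) (trans (cong (λ b → weight S (z j) * 𝟙 b) (sym (vz j)))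
        (∑≡0⇒∀≡0 Y clear (proj₁ (proj₂ (nb j)))))

      fresh : ∀ j {w} → w ∈ used S → ¬ Clash (z j) w
      fresh j w∈ = share≡0⇒¬Clash (∑≡0⇒∀≡0 (used S)
        (trans (sym (+-identityʳ _)) (trans (cong (λ b → 𝟙 b * ∑ (used S) (share (z j))) (sym (uz j)))
          (∑≡0⇒∀≡0 F (m+n≡0⇒n≡0 (∑[ i ⟵ F ] ∑[ i′ ⟵ F ] (distinct i i′ * (𝟙 (adj (u S i) (z j)) * 𝟙 (adj (u S i′) (z j))))) (weight≡0 j)) (∈-allFin j)))) w∈)

      z-inj : ∀ i j → Clash (z i) (z j) → i ≡ j
      z-inj i j c with i ≟ᶠ j
      ... | yes i≡j = i≡j
      ... | no  i≢j = ⊥-elim (1+n≢0 (trans (sym prod≡1) prod≡0))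
        where
        prod≡0 : distinct i j * (𝟙 (adj (u S i) (z j)) * 𝟙 (adj (u S j) (z j))) ≡ 0
        prod≡0 = ∑≡0⇒∀≡0 F (∑≡0⇒∀≡0 F (m+n≡0⇒m≡0 _ (weight≡0 j)) (∈-allFin i)) (∈-allFin j)
        prod≡1 : distinct i j * (𝟙 (adj (u S i) (z j)) * 𝟙 (adj (u S j) (z j))) ≡ 1
        prod≡1 = cong₂ _*_ (distinct≡1 i≢j) (cong₂ _*_
          (cong 𝟙 (subst (λ y → adj (u S i) y ≡ true) (clashʳ (vz i) (vz j) c) (uz i))) (cong 𝟙 (uz j)))

    extend-linked : Subdivision (suc k)
    extend-linked = extend S v z vz uz (λ j e → proj₁ (link⇒ (u S j) v (linked j)) (sym e)) fresh z-inj

  -- Growing a light clique round by round.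

  module Process (M D δ : ℕ) (0<M : 0 < M) (Y≤M : length Y ≤ M) (0<δ : 0 < δ) (δ≤D : δ ≤ D) (0<s : 0 < s) where

    -- `U` holds the candidates for all further branch vertices. The field `light` is what keeps the
    -- total weight below `R`; `min-deg` refers to the whole of `Y`, so it is inherited by sublists
    -- of `U`.
    record Stage (k : ℕ) : Set where
      field
        S       : Subdivision k
        light   : ∀ i j → i ≢ j → codeg (u S i) (u S j) < s
        U       : List (V m)
        U!      : Unique U
        linked  : ∀ {v} → v ∈ U → ∀ j → link (u S j) v ≡ true
        clear   : ∀ {v} → v ∈ U → obstruction S v ≡ 0
        max-deg : ∀ {y} → y ∈ Y → ∑[ v ⟵ U ] 𝟙 (adj v y) ≤ D
        min-deg : ∀ {v} → v ∈ U → δ ≤ deg v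

    open Stage

    c κ : ℕ
    c = 8 * t * M * s
    κ = 2 * c

    κ-linear : κ ≡ 16 * t * s * M
    κ-linear = rearrange t M s
      where rearrange : ∀ t M s → 2 * (8 * t * M * s) ≡ 16 * t * s * M
            rearrange = solve-∀

    c*2n≡κ*n : ∀ n → c * (2 * n) ≡ κ * n
    c*2n≡κ*n n = trans (sym (*-assoc c 2 n)) (cong (_* n) (*-comm c 2))

    0<c : 0 < c
    0<c = *-mono-≤ (*-mono-≤ (*-mono-≤ (s≤s {0} {7} z≤n) 0<t) 0<M) 0<s

    c≤κ : c ≤ κ
    c≤κ = m≤n*m c 2

    0<R : 0 < R
    0<R = max-obstruction-pos t s 0<t 0<s

    -- Summing over `y` first, each unit of weight spoils at most `D` vertices of `L`.
    few-obstructed : ∀ {k} (S : Subdivision k) → k ≤ t → (∀ i j → i ≢ j → codeg (u S i) (u S j) < s) →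
      ∀ L → (∀ {y} → y ∈ Y → ∑[ b ⟵ L ] 𝟙 (adj b y) ≤ D) →
      length L ≤ length (select (λ b → does (obstruction S b ≟ 0)) L) + R * D
    few-obstructed S k≤t light L max = ≤-trans (length≤zeros+∑ L (obstruction S)) (+-monoʳ-≤ _ (begin
      ∑ L (obstruction S)                                ≡⟨ ∑-swap L Y _ ⟩
      ∑[ y ⟵ Y ] ∑[ b ⟵ L ] (weight S y * 𝟙 (adj b y))
        ≤⟨ ∑-mono Y (λ {y} y∈ → ≤-trans (≤-reflexive (∑-*ˡ L (weight S y) _)) (*-monoʳ-≤ (weight S y) (max y∈))) ⟩
      ∑[ y ⟵ Y ] (weight S y * D)                        ≡⟨ ∑-*ʳ Y D _ ⟩
      ∑ Y (weight S) * D                                 ≤⟨ *-monoˡ-≤ D (∑-weight S k≤t light) ⟩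
      R * D                                              ∎))
      where open ≤-Reasoning

    -- The hypothesis makes the link neighbourhood of `v` at least 2RD long, so discarding the
    -- obstructed vertices at most halves it. This halving is the factor 2 between `c` and `κ`.
    advance-by : ∀ {k} → suc k ≤ t → (P : Stage k) → κ * (R * D) ≤ ∑ (U P) deg * δ →
      ∀ v → v ∈ U P → deg v * ∑ (U P) deg ≤ 8 * t * M * s * links (U P) v →
      Σ (Stage (suc k)) λ Q → R * D ≤ length (U Q) × ∑ (U P) deg * δ ≤ κ * length (U Q)
    advance-by {k} k<t P large v v∈ many = Q , RD≤ , grow
      where
      open ≤-Reasoning
      e = ∑ (U P) deg
      instance
        c≢0 : NonZero c
        c≢0 = >-nonZero 0<c
      S′ : Subdivision (suc k)
      S′ = extend-linked (S P) v (linked P v∈) (clear P v∈)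
      light′ : ∀ i j → i ≢ j → codeg (u S′ i) (u S′ j) < s
      light′ zero    zero    i≢j = ⊥-elim (i≢j refl)
      light′ zero    (suc j) _   = subst (_< s) (codeg-comm (u (S P) j) v) (proj₁ (proj₂ (link⇒ (u (S P) j) v (linked P v∈ j))))
      light′ (suc i) zero    _   = proj₁ (proj₂ (link⇒ (u (S P) i) v (linked P v∈ i)))
      light′ (suc i) (suc j) i≢j = light P i j (i≢j ∘ cong suc)
      L = select (link v) (U P)
      good : V m → Bool
      good b = does (obstruction S′ b ≟ 0)
      U′ = select good L
      U′⊆L : ∀ {b} → b ∈ U′ → b ∈ L
      U′⊆L b∈ = proj₁ (∈-select⁻ good L b∈)
      U′⊆U : ∀ {b} → b ∈ U′ → b ∈ U P
      U′⊆U b∈ = proj₁ (∈-select⁻ (link v) (U P) (U′⊆L b∈))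
      linked′ : ∀ {b} → b ∈ U′ → ∀ j → link (u S′ j) b ≡ true
      linked′ b∈ zero    = proj₂ (∈-select⁻ (link v) (U P) (U′⊆L b∈))
      linked′ b∈ (suc j) = linked P (U′⊆U b∈) j
      Q : Stage (suc k)
      Q = record
        { S = S′ ; light = light′ ; U = U′
        ; U! = filter⁺ (T? ∘ good) (filter⁺ (T? ∘ link v) (U! P))
        ; linked = linked′
        ; clear = λ {b} b∈ → does-true (obstruction S′ b ≟ 0) (proj₂ (∈-select⁻ good L b∈))
        ; max-deg = λ y∈ → ≤-trans (∑-select-≤ good L _) (≤-trans (∑-select-≤ (link v) (U P) _) (max-deg P y∈))
        ; min-deg = λ b∈ → min-deg P (U′⊆U b∈) }
      eδ≤cL : e * δ ≤ c * length L
      eδ≤cL = begin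
        e * δ          ≡⟨ *-comm e δ ⟩
        δ * e          ≤⟨ *-monoˡ-≤ e (min-deg P v∈) ⟩
        deg v * e      ≤⟨ many ⟩
        c * length L   ∎
      2RD≤L : 2 * (R * D) ≤ length L
      2RD≤L = *-cancelˡ-≤ c (begin
        c * (2 * (R * D)) ≡⟨ c*2n≡κ*n (R * D) ⟩
        κ * (R * D)       ≤⟨ large ⟩
        e * δ             ≤⟨ eδ≤cL ⟩
        c * length L      ∎)
      L≤ : length L ≤ length U′ + R * D
      L≤ = few-obstructed S′ k<t light′ L λ y∈ → ≤-trans (∑-select-≤ (link v) (U P) _) (max-deg P y∈)
      RD≤ : R * D ≤ length U′
      RD≤ = +-cancelʳ-≤ (R * D) _ _ (≤-trans (≤-reflexive (cong (R * D +_) (sym (+-identityʳ (R * D))))) (≤-trans 2RD≤L L≤))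
      L≤2U′ : length L ≤ 2 * length U′
      L≤2U′ = ≤-trans L≤ (+-monoʳ-≤ _ (≤-trans RD≤ (≤-reflexive (sym (+-identityʳ _)))))
      grow : e * δ ≤ κ * length U′
      grow = begin
        e * δ                  ≤⟨ eδ≤cL ⟩
        c * length L           ≤⟨ *-monoʳ-≤ c L≤2U′ ⟩
        c * (2 * length U′)    ≡⟨ c*2n≡κ*n (length U′) ⟩
        κ * length U′          ∎

    abstract
      advance : ∀ {k} → suc k ≤ t → (P : Stage k) → κ * (R * D) ≤ ∑ (U P) deg * δ →
        Σ (Stage (suc k)) λ Q → R * D ≤ length (U Q) × ∑ (U P) deg * δ ≤ κ * length (U Q)
      advance {k} k<t P large =
        let v , v∈ , many = linked-vertex M (U P) (U! P) Y≤M enough 0<e in advance-by k<t P large v v∈ many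
        where
        open ≤-Reasoning
        e : ℕ
        e = ∑ (U P) deg
        instance
          δ≢0 : NonZero δ
          δ≢0 = >-nonZero 0<δ
        enough : 8 * t * M ≤ e
        enough = *-cancelʳ-≤ (8 * t * M) e δ (begin
          8 * t * M * δ             ≤⟨ *-mono-≤ (m≤m*n (8 * t * M) s {{>-nonZero 0<s}}) δ≤D ⟩
          c * D                     ≤⟨ *-mono-≤ c≤κ (m≤n*m D R {{>-nonZero 0<R}}) ⟩
          κ * (R * D)               ≤⟨ large ⟩
          e * δ                     ∎)
        0<e : 0 < e
        0<e = ≤-trans (*-mono-≤ (*-mono-≤ (s≤s {0} {7} z≤n) 0<t) 0<M) enough

    -- The hypothesis at `j` says that there are enough edges to advance once more after `j` further
    -- rounds. It is asked for all `j ≤ i`, because δ² / κ may lie on either side of 1, so that no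
    -- single `j` is the hardest in advance.
    process : ∀ i k → suc (suc (k + i)) ≡ t → (P : Stage k) →
      (∀ j → j ≤ i → κ ^ suc j * (R * D) ≤ ∑ (U P) deg * δ ^ suc (2 * j)) → ⊥
    process i k eq P inv
      with advance (≤-trans (s≤s (m≤n⇒m≤1+n (m≤m+n k i))) (≤-reflexive eq)) P
             (subst₂ _≤_ (cong (_* (R * D)) (*-identityʳ κ)) (cong (∑ (U P) deg *_) (*-identityʳ δ)) (inv 0 z≤n))
    -- The last branch vertex starts no further round: any surviving candidate completes the
    -- subdivision.
    process zero k eq P inv | Q , RD≤ , _
      with member (U Q) (≤-trans (*-mono-≤ 0<R (≤-trans 0<δ δ≤D)) RD≤)
      where
      member : ∀ (xs : List (V m)) → 0 < length xs → ∃ λ x → x ∈ xs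
      member (x ∷ _) _ = x , here refl
    ... | b , b∈ = none (subst Subdivision (trans (cong (2 +_) (sym (+-identityʳ k))) eq)
                       (extend-linked (S Q) b (linked Q b∈) (clear Q b∈)))
    process (suc i) k eq P inv | Q , _ , grow =
      process i (suc k) (trans (cong (2 +_) (sym (+-suc k i))) eq) Q inv′
      where
      open ≤-Reasoning
      shuffle : ∀ a b d x → a * b * (d * x) ≡ a * (b * d * x)
      shuffle = solve-∀
      degrees : length (U Q) * δ ≤ ∑ (U Q) deg
      degrees = ≤-trans (≤-reflexive (sym (∑-const (U Q) δ))) (∑-mono (U Q) (min-deg Q))
      -- `grow` gives one factor δ / κ, and the minimal degree turns the new vertex count into edges
      -- with another δ.
      inv′ : ∀ j → j ≤ i → κ ^ suc j * (R * D) ≤ ∑ (U Q) deg * δ ^ suc (2 * j)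
      inv′ j j≤i = *-cancelˡ-≤ κ {{>-nonZero (≤-trans 0<c c≤κ)}} (begin
        κ * (κ ^ suc j * (R * D))                       ≡⟨ *-assoc κ (κ ^ suc j) (R * D) ⟨
        κ ^ suc (suc j) * (R * D)                       ≤⟨ inv (suc j) (s≤s j≤i) ⟩
        ∑ (U P) deg * δ ^ suc (2 * suc j)               ≡⟨ cong (λ z → ∑ (U P) deg * δ ^ suc z) (*-suc 2 j) ⟩
        ∑ (U P) deg * (δ * (δ * δ ^ suc (2 * j)))       ≡⟨ *-assoc (∑ (U P) deg) δ _ ⟨
        ∑ (U P) deg * δ * (δ * δ ^ suc (2 * j))         ≤⟨ *-monoˡ-≤ _ grow ⟩
        κ * length (U Q) * (δ * δ ^ suc (2 * j))        ≡⟨ shuffle κ (length (U Q)) δ (δ ^ suc (2 * j)) ⟩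
        κ * (length (U Q) * δ * δ ^ suc (2 * j))        ≤⟨ *-monoʳ-≤ κ (*-monoˡ-≤ _ degrees) ⟩
        κ * (∑ (U Q) deg * δ ^ suc (2 * j))             ∎)

    no-large-stage : ∀ r → 2 + r ≡ t → ∀ U → Unique U → (∀ {y} → y ∈ Y → ∑[ v ⟵ U ] 𝟙 (adj v y) ≤ D) →
      (∀ {v} → v ∈ U → δ ≤ deg v) →
      (∀ j → j ≤ r → (16 * t * s * M) ^ suc j * (max-obstruction t s * D) ≤ ∑ U deg * δ ^ suc (2 * j)) → ⊥
    no-large-stage r eq U U! max min inv = process r 0 eq stage
      λ j j≤r → subst (λ κ → κ ^ suc j * (R * D) ≤ ∑ U deg * δ ^ suc (2 * j)) (sym κ-linear) (inv j j≤r)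
      where
      stage : Stage 0
      stage = record
        { S = empty ; light = λ () ; U = U ; U! = U! ; linked = λ _ () ; clear = λ _ → ∑-zero Y
        ; max-deg = max ; min-deg = min }

-- Fractional exponents, and bounding the degrees on one side.

^-distribʳ-* : ∀ a b k → (a * b) ^ k ≡ a ^ k * b ^ k
^-distribʳ-* a b zero    = refl
^-distribʳ-* a b (suc k) = trans (cong (a * b *_) (^-distribʳ-* a b k)) (swap a b (a ^ k) (b ^ k))
  where swap : ∀ a b x y → a * b * (x * y) ≡ a * x * (b * y)
        swap = solve-∀

^-cancelˡ-≤ : ∀ k {a b} → a ^ suc k ≤ b ^ suc k → a ≤ b
^-cancelˡ-≤ k le = ≮⇒≥ λ lt → <⇒≱ (^-monoˡ-< (suc k) lt) le

-- The hypothesis says δ ≥ g M^(r/(2r+1)), and j/(2j+1) increases with j.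
lower-exponent : ∀ g δ M {r j} → 0 < M → j ≤ r →
  g ^ suc (2 * r) * M ^ r ≤ δ ^ suc (2 * r) → g ^ suc (2 * j) * M ^ j ≤ δ ^ suc (2 * j)
lower-exponent g δ M {r} {j} 0<M j≤r h = ^-cancelˡ-≤ (2 * r) (begin
  (g ^ b * M ^ j) ^ a             ≡⟨ ^-distribʳ-* (g ^ b) (M ^ j) a ⟩
  (g ^ b) ^ a * (M ^ j) ^ a       ≡⟨ cong₂ _*_ (exchange g b a) (^-*-assoc M j a) ⟩
  (g ^ a) ^ b * M ^ (j * a)       ≤⟨ *-monoʳ-≤ ((g ^ a) ^ b) (^-monoʳ-≤ M {{>-nonZero 0<M}} exps) ⟩
  (g ^ a) ^ b * M ^ (r * b)       ≡⟨ cong ((g ^ a) ^ b *_) (^-*-assoc M r b) ⟨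
  (g ^ a) ^ b * (M ^ r) ^ b       ≡⟨ ^-distribʳ-* (g ^ a) (M ^ r) b ⟨
  (g ^ a * M ^ r) ^ b             ≤⟨ ^-monoˡ-≤ b h ⟩
  (δ ^ a) ^ b                     ≡⟨ exchange δ a b ⟩
  (δ ^ b) ^ a                     ∎)
  where
  open ≤-Reasoning
  a = suc (2 * r)
  b = suc (2 * j)
  exchange : ∀ x m n → (x ^ m) ^ n ≡ (x ^ n) ^ m
  exchange x m n = trans (^-*-assoc x m n) (trans (cong (x ^_) (*-comm m n)) (sym (^-*-assoc x n m)))
  split : ∀ j r → j * suc (2 * r) ≡ j + 2 * (j * r)
  split = solve-∀
  exps : j * a ≤ r * b
  exps = begin
    j * a            ≡⟨ split j r ⟩
    j + 2 * (j * r)  ≤⟨ +-monoˡ-≤ _ j≤r ⟩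
    r + 2 * (j * r)  ≡⟨ cong (λ z → r + 2 * z) (*-comm j r) ⟩
    r + 2 * (r * j)  ≡⟨ split r j ⟨
    r * b            ∎

-- `dense` reads: twice the edges is at least G M^(r/(2r+1)), with `G` unchanged when `Y` shrinks.
-- The 2 here, and the 16 in place of 8, allow for half of the edges being lost with the high
-- vertices; `M` is the length before that loss.
record Regularised {A : Set} (d : A → ℕ) (r G : ℕ) (Y : List A) : Set where
  field
    Y′      : List A
    M       : ℕ
    unique  : Unique Y → Unique Y′
    Y′≤M    : length Y′ ≤ M
    M≤Y     : M ≤ length Y
    0<M     : 0 < M
    max-deg : ∀ {y} → y ∈ Y′ → d y * M ≤ 16 * ∑ Y′ d
    dense   : G ^ suc (2 * r) * M ^ r ≤ (2 * ∑ Y′ d) ^ suc (2 * r)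

-- Vertices of degree above eight times the average are few; if they carry half of the
-- edges, the density hypothesis passes to them.
regularise : ∀ {A : Set} (d : A → ℕ) r → 1 ≤ r → ∀ G n Y → length Y < n → 0 < ∑ Y d →
  G ^ suc (2 * r) * length Y ^ r ≤ ∑ Y d ^ suc (2 * r) → Regularised d r G Y
regularise d r 1≤r G (suc n) Y (s≤s Y≤n) 0<E dense = decide (E ≤? 2 * EH)
  where
  open ≤-Reasoning
  a = suc (2 * r)
  E = ∑ Y d
  M = length Y
  high : _ → Bool
  high y = does (8 * E <? d y * M)
  H = select high Y
  L = select (not ∘ high) Y
  EH = ∑ H d
  EL = ∑ L d
  0<M : ∀ Y → 0 < ∑ Y d → 0 < length Y
  0<M (_ ∷ _) _ = z<s
  H-small : 8 * length H ≤ M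
  H-small = *-cancelʳ-≤ (8 * length H) M E {{>-nonZero 0<E}} (begin
    8 * length H * E           ≡⟨ rot (length H) E ⟩
    length H * (8 * E)         ≡⟨ ∑-const H (8 * E) ⟨
    ∑[ y ⟵ H ] (8 * E)         ≤⟨ ∑-mono H (λ {y} y∈ → <⇒≤ (does-true (8 * E <? d y * M) (proj₂ (∈-select⁻ high Y y∈)))) ⟩
    ∑[ y ⟵ H ] (d y * M)       ≡⟨ ∑-*ʳ H M d ⟩
    EH * M                     ≤⟨ *-monoˡ-≤ M (∑-select-≤ high Y d) ⟩
    E * M                      ≡⟨ *-comm E M ⟩
    M * E                      ∎)
    where rot : ∀ h e → 8 * h * e ≡ h * (8 * e)
          rot = solve-∀
  weaken : Regularised d r G H → Regularised d r G Y
  weaken P = record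
    { Y′ = Y′ ; M = Regularised.M P ; unique = unique ∘ filter⁺ (T? ∘ high) ; Y′≤M = Y′≤M
    ; M≤Y = ≤-trans M≤Y (≤-trans (m≤n*m (length H) 8) H-small)
    ; 0<M = Regularised.0<M P ; max-deg = max-deg ; dense = Regularised.dense P }
    where open Regularised P hiding (M; 0<M; dense)
  denseH : E ≤ 2 * EH → G ^ a * length H ^ r ≤ EH ^ a
  denseH le = *-cancelˡ-≤ (2 ^ a) {{m^n≢0 2 a}} (begin
    2 ^ a * (G ^ a * length H ^ r)        ≤⟨ *-monoˡ-≤ _ (^-monoʳ-≤ 2 exps) ⟩
    2 ^ (3 * r) * (G ^ a * length H ^ r)  ≡⟨ cong (_* (G ^ a * length H ^ r)) (^-*-assoc 2 3 r) ⟨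
    8 ^ r * (G ^ a * length H ^ r)        ≡⟨ rot (8 ^ r) (G ^ a) (length H ^ r) ⟩
    G ^ a * (8 ^ r * length H ^ r)        ≡⟨ cong (G ^ a *_) (^-distribʳ-* 8 (length H) r) ⟨
    G ^ a * (8 * length H) ^ r            ≤⟨ *-monoʳ-≤ (G ^ a) (^-monoˡ-≤ r H-small) ⟩
    G ^ a * M ^ r                         ≤⟨ dense ⟩
    E ^ a                                 ≤⟨ ^-monoˡ-≤ a le ⟩
    (2 * EH) ^ a                          ≡⟨ ^-distribʳ-* 2 EH a ⟩
    2 ^ a * EH ^ a                        ∎)
    where
    rot : ∀ x y z → x * (y * z) ≡ y * (x * z)
    rot = solve-∀
    -- Edges at most halve while the vertices drop to an eighth, so 2^(2r+1) is paid by 8^r. This is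
    -- where t ≥ 3 enters.
    exps : a ≤ 3 * r
    exps = +-monoˡ-≤ (2 * r) 1≤r
  -- The recursion is on the bound `n`, as `H` is no structural part of `Y`.
  H<n : length H < n
  H<n = ≤-trans (shrink (length H) H-small (0<M Y 0<E)) Y≤n
    where
    shrink : ∀ h {k} → 8 * h ≤ k → 0 < k → h < k
    shrink zero    _  0<k = 0<k
    shrink (suc h) le _   = <-≤-trans (m<m*n (suc h) 8 (s≤s z<s)) (≤-trans (≤-reflexive (*-comm (suc h) 8)) le)
  decide : Dec (E ≤ 2 * EH) → Regularised d r G Y
  decide (yes le) = weaken (regularise d r 1≤r G n H H<n 0<EH (denseH le))
    where
    0<EH : 0 < EH
    0<EH = n≢0⇒n>0 λ e → <⇒≱ 0<E (≤-trans le (≤-reflexive (cong (2 *_) e)))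
  decide (no nle) = record
    { Y′ = L ; M = M ; unique = filter⁺ (T? ∘ not ∘ high)
    ; Y′≤M = ≤-trans (m≤n+m _ _) (≤-reflexive (length-split high Y))
    ; M≤Y = ≤-refl ; 0<M = 0<M Y 0<E
    ; max-deg = λ {y} y∈ → begin
        d y * M         ≤⟨ low y∈ ⟩
        8 * E           ≤⟨ *-monoʳ-≤ 8 E≤2EL ⟩
        8 * (2 * EL)    ≡⟨ *-assoc 8 2 EL ⟨
        16 * EL         ∎
    ; dense = ≤-trans dense (^-monoˡ-≤ a E≤2EL) }
    where
    E≤2EL : E ≤ 2 * EL
    E≤2EL = +-cancelʳ-≤ (2 * EH) _ _ (begin
      E + 2 * EH         ≤⟨ +-monoʳ-≤ E (<⇒≤ (≰⇒> nle)) ⟩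
      E + E              ≡⟨ cong (E +_) (+-identityʳ E) ⟨
      2 * E              ≡⟨ cong (2 *_) (trans (sym (∑-split high Y d)) (+-comm EH EL)) ⟩
      2 * (EL + EH)      ≡⟨ *-distribˡ-+ 2 EL EH ⟩
      2 * EL + 2 * EH    ∎)
    low : ∀ {y} → y ∈ L → d y * M ≤ 8 * E
    low {y} y∈ = ≮⇒≥ (does-true (¬? (8 * E <? d y * M)) (proj₂ (∈-select⁻ (not ∘ high) Y y∈)))

-- From edge density to a subdivision.

vertices : ∀ m → List (V m)
vertices m = cartesianProduct (allFin m) (allFin m)

vertices-unique : ∀ m → Unique (vertices m)
vertices-unique m = cartesianProduct⁺ (allFin⁺ m) (allFin⁺ m)

module _ {m} (I : Incidence m) (0<m : 0 < m) (r t s g N : ℕ) (1≤r : 1 ≤ r) (t-def : 2 + r ≡ t)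
  (0<t : 0 < t) (2t²≤s : t * t * 2 ≤ s) (0<s : 0 < s) (0<g : 0 < g)
  (g-def : 16 * t * s * (32 * max-obstruction t s) ≡ g) (N-def : length (vertices m) ≡ N) where
  open Incidence I

  colour-degree : V m → ℕ
  colour-degree y = ∑[ x ⟵ vertices m ] 𝟙 (adj x y)

  private
    0<N : 0 < N
    0<N = subst (0 <_) N-def (nonempty m 0<m)
      where nonempty : ∀ m → 0 < m → 0 < length (vertices m)
            nonempty (suc m) _ = z<s

  module _ (P : Regularised colour-degree r (8 * g * N) (vertices m)) (none : ¬ Subdivision t) where
    open Regularised P
    private
      instance
        M≢0 : NonZero M
        M≢0 = >-nonZero 0<M
        2N≢0 : NonZero (2 * N)
        2N≢0 = >-nonZero (*-mono-≤ (s≤s {0} {1} z≤n) 0<N)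
      Y′! : Unique Y′
      Y′! = unique (vertices-unique m)

    private
      k = 16 * t * s
      deg = degree I Y′
      R = max-obstruction t s
    open ≤-Reasoning

    private
      a E δ D : ℕ
      a = suc (2 * r)
      E = ∑ Y′ colour-degree
      -- Half the average degree over all N vertices, so that dropping the vertices of smaller
      -- degree loses at most half of the edges.
      δ = E / (2 * N)
      D = 16 * E / M

      E-deg : E ≡ ∑ (vertices m) deg
      E-deg = ∑-swap Y′ (vertices m) _

      4gN≤E : 4 * g * N ≤ E
      4gN≤E = *-cancelˡ-≤ 2 (begin
        2 * (4 * g * N)   ≡⟨ double g N ⟩
        8 * g * N         ≤⟨ ^-cancelˡ-≤ (2 * r) (≤-trans (m≤m*n _ (M ^ r) {{m^n≢0 M r}}) dense) ⟩
        2 * E             ∎)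
        where double : ∀ g N → 2 * (4 * g * N) ≡ 8 * g * N
              double = solve-∀

      2N≤E : 2 * N ≤ E
      2N≤E = ≤-trans (*-monoˡ-≤ N (*-mono-≤ (s≤s (s≤s (z≤n {2}))) 0<g)) 4gN≤E

      0<δ : 0 < δ
      0<δ = m≥n⇒m/n>0 2N≤E

      δ2N≤E : δ * (2 * N) ≤ E
      δ2N≤E = m/n*n≤m E (2 * N)

      E≤δ4N : E ≤ δ * (4 * N)
      E≤δ4N = begin
        E                                   ≡⟨ m≡m%n+[m/n]*n E (2 * N) ⟩
        E % (2 * N) + δ * (2 * N)           ≤⟨ +-monoˡ-≤ _ (<⇒≤ (m%n<n E (2 * N))) ⟩
        2 * N + δ * (2 * N)                 ≤⟨ +-monoˡ-≤ _ (m≤n*m (2 * N) δ {{>-nonZero 0<δ}}) ⟩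
        δ * (2 * N) + δ * (2 * N)           ≡⟨ collect δ N ⟩
        δ * (4 * N)                         ∎
        where collect : ∀ δ N → δ * (2 * N) + δ * (2 * N) ≡ δ * (4 * N)
              collect = solve-∀

      -- The 8 in `8 * g * N` pays for the 2 in `dense` and for the 4 in `E≤δ4N`, the latter being
      -- the halved average and the rounding.
      δ-large : g ^ a * M ^ r ≤ δ ^ a
      δ-large = *-cancelˡ-≤ ((8 * N) ^ a) {{m^n≢0 (8 * N) a {{>-nonZero (*-mono-≤ (s≤s {0} {7} z≤n) 0<N)}}}} (begin
        (8 * N) ^ a * (g ^ a * M ^ r)       ≡⟨ *-assoc ((8 * N) ^ a) (g ^ a) (M ^ r) ⟨
        (8 * N) ^ a * g ^ a * M ^ r         ≡⟨ cong (_* M ^ r) (^-distribʳ-* (8 * N) g a) ⟨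
        (8 * N * g) ^ a * M ^ r             ≡⟨ cong (λ z → z ^ a * M ^ r) (swap N g) ⟩
        (8 * g * N) ^ a * M ^ r             ≤⟨ dense ⟩
        (2 * E) ^ a                         ≤⟨ ^-monoˡ-≤ a (*-monoʳ-≤ 2 E≤δ4N) ⟩
        (2 * (δ * (4 * N))) ^ a             ≡⟨ cong (_^ a) (pull δ N) ⟩
        (8 * N * δ) ^ a                     ≡⟨ ^-distribʳ-* (8 * N) δ a ⟩
        (8 * N) ^ a * δ ^ a                 ∎)
        where
        swap : ∀ N g → 8 * N * g ≡ 8 * g * N
        swap = solve-∀
        pull : ∀ δ N → 2 * (δ * (4 * N)) ≡ 8 * N * δ
        pull = solve-∀

      δ≤D : δ ≤ D
      δ≤D = subst (_≤ D) (m*n/n≡m δ M) (/-monoˡ-≤ M (begin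
        δ * M         ≤⟨ *-monoʳ-≤ δ (≤-trans (≤-trans M≤Y (≤-reflexive N-def)) (m≤n*m N 2)) ⟩
        δ * (2 * N)   ≤⟨ δ2N≤E ⟩
        E             ≤⟨ m≤n*m E 16 ⟩
        16 * E        ∎))

      wide : V m → Bool
      wide x = does (δ ≤? deg x)

      X₀ = select wide (vertices m)
      E₀ = ∑ X₀ deg

      E≤2E₀ : E ≤ 2 * E₀
      E≤2E₀ = +-cancelʳ-≤ E _ _ (begin
        E + E                             ≡⟨ cong (E +_) (+-identityʳ E) ⟨
        2 * E                             ≡⟨ cong (2 *_) (trans E-deg (sym (∑-split wide (vertices m) deg))) ⟩
        2 * (E₀ + thin)                   ≡⟨ *-distribˡ-+ 2 E₀ thin ⟩
        2 * E₀ + 2 * thin                 ≤⟨ +-monoʳ-≤ (2 * E₀) (*-monoʳ-≤ 2 thin≤) ⟩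
        2 * E₀ + 2 * (N * δ)              ≡⟨ cong (2 * E₀ +_) (rot N δ) ⟩
        2 * E₀ + δ * (2 * N)              ≤⟨ +-monoʳ-≤ (2 * E₀) δ2N≤E ⟩
        2 * E₀ + E                        ∎)
        where
        thin = ∑ (select (not ∘ wide) (vertices m)) deg
        rot : ∀ N δ → 2 * (N * δ) ≡ δ * (2 * N)
        rot = solve-∀
        thin≤ : thin ≤ N * δ
        thin≤ = begin
          thin                                                ≤⟨ ∑-≤const (select (not ∘ wide) (vertices m)) δ (λ {x} x∈ → <⇒≤ (≰⇒> (does-true (¬? (δ ≤? deg x)) (proj₂ (∈-select⁻ (not ∘ wide) (vertices m) x∈))))) ⟩
          length (select (not ∘ wide) (vertices m)) * δ       ≤⟨ *-monoˡ-≤ δ (≤-trans (m≤n+m (length (select (not ∘ wide) (vertices m))) (length X₀)) (≤-reflexive (trans (length-split wide (vertices m)) N-def))) ⟩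
          N * δ                                               ∎

      DM≤32E₀ : D * M ≤ 32 * E₀
      DM≤32E₀ = begin
        D * M            ≤⟨ m/n*n≤m (16 * E) M ⟩
        16 * E           ≤⟨ *-monoʳ-≤ 16 E≤2E₀ ⟩
        16 * (2 * E₀)    ≡⟨ *-assoc 16 2 E₀ ⟨
        32 * E₀          ∎

    private
      -- `DM≤32E₀` trades D M for the edges. The constants left over are k^j times 32 k R, at most
      -- g^(j+1): this is the origin of `g`. The rest is `lower-exponent`.
      initial : ∀ j → j ≤ r → (k * M) ^ suc j * (R * D) ≤ E₀ * δ ^ suc (2 * j)
      initial j j≤r = *-cancelˡ-≤ 32 (begin
        32 * ((k * M) ^ suc j * (R * D))          ≡⟨ cong (λ z → 32 * (z * (R * D))) (^-distribʳ-* k M (suc j)) ⟩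
        32 * (k ^ suc j * M ^ suc j * (R * D))    ≡⟨ gather k (k ^ j) M (M ^ j) R D ⟩
        k ^ j * (k * (32 * R)) * (M ^ j * (D * M)) ≡⟨ cong (λ z → k ^ j * z * (M ^ j * (D * M))) g-def ⟩
        k ^ j * g * (M ^ j * (D * M))             ≤⟨ *-mono-≤ (*-monoˡ-≤ g (^-monoˡ-≤ j k≤g)) (*-monoʳ-≤ (M ^ j) DM≤32E₀) ⟩
        g ^ j * g * (M ^ j * (32 * E₀))           ≡⟨ ungather (g ^ j) g (M ^ j) E₀ ⟩
        32 * (E₀ * (g ^ suc j * M ^ j))           ≤⟨ *-monoʳ-≤ 32 (*-monoʳ-≤ E₀ (*-monoˡ-≤ (M ^ j) (^-monoʳ-≤ g {{>-nonZero 0<g}} (s≤s (m≤n*m j 2))))) ⟩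
        32 * (E₀ * (g ^ suc (2 * j) * M ^ j))     ≤⟨ *-monoʳ-≤ 32 (*-monoʳ-≤ E₀ (lower-exponent g δ M 0<M j≤r δ-large)) ⟩
        32 * (E₀ * δ ^ suc (2 * j))               ∎)
        where
        k≤g : k ≤ g
        k≤g = ≤-trans (m≤m*n k (32 * R) {{>-nonZero (*-mono-≤ (s≤s {0} {31} z≤n) (max-obstruction-pos t s 0<t 0<s))}}) (≤-reflexive g-def)
        gather : ∀ k kj M Mj R D → 32 * (k * kj * (M * Mj) * (R * D)) ≡ kj * (k * (32 * R)) * (Mj * (D * M))
        gather = solve-∀
        ungather : ∀ gj g Mj E → gj * g * (Mj * (32 * E)) ≡ 32 * (E * (g * gj * Mj))
        ungather = solve-∀

    regular⇒¬none : ⊥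
    regular⇒¬none = LinkedPairs.Process.no-large-stage I Y′ Y′! t s 2t²≤s 0<t none M D δ 0<M Y′≤M 0<δ δ≤D 0<s r t-def X₀
      (filter⁺ (T? ∘ wide) (vertices-unique m))
      (λ {y} y∈ → ≤-trans (∑-select-≤ wide (vertices m) _)
         (subst (_≤ D) (m*n/n≡m (colour-degree y) M) (/-monoˡ-≤ M (max-deg y∈))))
      (λ {x} x∈ → does-true (δ ≤? deg x) (proj₂ (∈-select⁻ wide (vertices m) x∈)))
      initial

  -- The hypothesis says that there are at least 8 g N^(1 + r/(2r+1)) edges; for t = r + 2 this
  -- exponent is 3/2 - 1/(4t - 6).
  dense⇒subdivision : (8 * g * N) ^ suc (2 * r) * N ^ r ≤ ∑ (vertices m) colour-degree ^ suc (2 * r) → ¬ ¬ Subdivision t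
  dense⇒subdivision dense = regular⇒¬none
    (regularise colour-degree r 1≤r (8 * g * N) (suc N) (vertices m) (s≤s (≤-reflexive N-def)) 0<E
      (subst (λ n → (8 * g * N) ^ suc (2 * r) * n ^ r ≤ ∑ (vertices m) colour-degree ^ suc (2 * r)) (sym N-def) dense))
    where
    0<E : 0 < ∑ (vertices m) colour-degree
    0<E = n≢0⇒n>0 λ e → <⇒≱ (*-mono-≤ (m^n>0 (8 * g * N) {{>-nonZero (*-mono-≤ (*-mono-≤ (s≤s {0} {7} z≤n) 0<g) 0<N)}} (suc (2 * r))) (m^n>0 N {{>-nonZero 0<N}} r))
                        (≤-trans dense (≤-reflexive (cong (_^ suc (2 * r)) e)))

-- Cuts that keep at least a quarter of the off-diagonal weight.

∑∑ : ∀ {n} → (Fin n → Fin n → ℕ) → ℕ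
∑∑ {n} w = ∑[ i ⟵ allFin n ] ∑[ j ⟵ allFin n ] w i j

∑∑-suc : ∀ n (w : Fin (suc n) → Fin (suc n) → ℕ) →
  ∑∑ w ≡ w zero zero + (∑[ j ⟵ allFin n ] (w zero (suc j) + w (suc j) zero) + ∑∑ λ i j → w (suc i) (suc j))
∑∑-suc n w = begin
  ∑∑ w
    ≡⟨ ∑-allFin-suc n _ ⟩
  ∑ (allFin (suc n)) (w zero) + ∑[ i ⟵ allFin n ] ∑ (allFin (suc n)) (w (suc i))
    ≡⟨ cong₂ _+_ (∑-allFin-suc n _) (trans (∑-cong (allFin n) λ i → ∑-allFin-suc n _) (∑-+ (allFin n) _ _)) ⟩
  (w zero zero + ∑[ j ⟵ allFin n ] w zero (suc j)) + (∑[ i ⟵ allFin n ] w (suc i) zero + ∑∑ λ i j → w (suc i) (suc j))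
    ≡⟨ regroup (w zero zero) _ _ _ ⟩
  w zero zero + ((∑[ j ⟵ allFin n ] w zero (suc j) + ∑[ i ⟵ allFin n ] w (suc i) zero) + ∑∑ λ i j → w (suc i) (suc j))
    ≡⟨ cong (λ z → w zero zero + (z + ∑∑ λ i j → w (suc i) (suc j))) (∑-+ (allFin n) _ _) ⟨
  w zero zero + (∑[ j ⟵ allFin n ] (w zero (suc j) + w (suc j) zero) + ∑∑ λ i j → w (suc i) (suc j)) ∎
  where
  open ≡-Reasoning
  regroup : ∀ a b c d → (a + b) + (c + d) ≡ a + ((b + c) + d)
  regroup = solve-∀

cut : ∀ {n} → (Fin n → Bool) → (Fin n → Fin n → ℕ) → ℕ
cut f w = ∑∑ λ i j → 𝟙 (f i xor f j) * w i j

-- A random bipartition made deterministic: vertices are placed one by one, each on the side that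
-- cuts at least half of its weight, in both directions, to those already placed. Diagonal weight is
-- never cut.
max-cut : ∀ n (w : Fin n → Fin n → ℕ) → ∃ λ f → ∑∑ w ≤ 2 * cut f w + ∑[ i ⟵ allFin n ] w i i
max-cut zero    w = (λ ()) , z≤n
max-cut (suc n) w with max-cut n (λ i j → w (suc i) (suc j))
... | f , ih = pick (2 * side false ≤? ∑ F v)
  where
  open ≤-Reasoning
  F = allFin n
  v : Fin n → ℕ
  v j = w zero (suc j) + w (suc j) zero
  w′ : Fin n → Fin n → ℕ
  w′ i j = w (suc i) (suc j)
  side : Bool → ℕ
  side b = ∑[ j ⟵ F ] (𝟙 (b xor f j) * v j)
  both : side true + side false ≡ ∑ F v
  both = trans (sym (∑-+ F _ _)) (∑-cong F λ j → one (f j) (v j))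
    where
    one : ∀ b x → 𝟙 (true xor b) * x + 𝟙 (false xor b) * x ≡ x
    one true  x = +-identityʳ x
    one false x = trans (+-identityʳ _) (+-identityʳ x)
  f⁺ : Bool → Fin (suc n) → Bool
  f⁺ b zero    = b
  f⁺ b (suc i) = f i
  xor-self : ∀ b → 𝟙 (b xor b) ≡ 0
  xor-self true  = refl
  xor-self false = refl
  xor-sym : ∀ a b → 𝟙 (a xor b) ≡ 𝟙 (b xor a)
  xor-sym true  true  = refl
  xor-sym true  false = refl
  xor-sym false true  = refl
  xor-sym false false = refl
  cut-f⁺ : ∀ b → cut (f⁺ b) w ≡ side b + cut f w′
  cut-f⁺ b = trans (∑∑-suc n _) (cong₂ _+_ (cong (_* w zero zero) (xor-self b)) (cong (_+ cut f w′)
    (∑-cong F λ j → trans (cong (λ z → 𝟙 (b xor f j) * w zero (suc j) + z * w (suc j) zero) (xor-sym (f j) b))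
                          (sym (*-distribˡ-+ (𝟙 (b xor f j)) _ _)))))
  enough : ∀ b → ∑ F v ≤ 2 * side b → ∑∑ w ≤ 2 * cut (f⁺ b) w + ∑[ i ⟵ allFin (suc n) ] w i i
  enough b le = begin
    ∑∑ w                                              ≡⟨ ∑∑-suc n w ⟩
    w zero zero + (∑ F v + ∑∑ w′)                      ≤⟨ +-monoʳ-≤ (w zero zero) (+-mono-≤ le ih) ⟩
    w zero zero + (2 * side b + (2 * cut f w′ + ∑[ i ⟵ F ] w′ i i))
      ≡⟨ regroup (w zero zero) (side b) (cut f w′) _ ⟩
    2 * (side b + cut f w′) + (w zero zero + ∑[ i ⟵ F ] w′ i i)
      ≡⟨ cong₂ (λ x y → 2 * x + y) (cut-f⁺ b) (∑-allFin-suc n _) ⟨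
    2 * cut (f⁺ b) w + ∑[ i ⟵ allFin (suc n) ] w i i   ∎
    where
    regroup : ∀ a s c d → a + (2 * s + (2 * c + d)) ≡ 2 * (s + c) + (a + d)
    regroup = solve-∀
  larger : ∀ x y {z} → x + y ≡ z → 2 * y ≤ z → z ≤ 2 * x
  larger x y refl le = +-cancelʳ-≤ (2 * y) _ _
    (≤-trans (+-monoʳ-≤ (x + y) le) (≤-reflexive (double x y)))
    where double : ∀ x y → (x + y) + (x + y) ≡ 2 * x + 2 * y
          double = solve-∀
  pick : Dec (2 * side false ≤ ∑ F v) → ∃ λ f → ∑∑ w ≤ 2 * cut f w + ∑[ i ⟵ allFin (suc n) ] w i i
  pick (yes le) = f⁺ true , enough true (larger (side true) (side false) both le)
  pick (no nle) = f⁺ false , enough false (<⇒≤ (≰⇒> nle))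

arcs : ∀ {n} → (Fin n → Bool) → (Fin n → Fin n → ℕ) → ℕ
arcs f w = ∑∑ λ i j → 𝟙 (f i) * 𝟙 (not (f j)) * w i j

-- Each cut pair runs from `f` to its complement or back; the better direction has half of the cut.
max-arcs : ∀ n (w : Fin n → Fin n → ℕ) → ∃ λ f → ∑∑ w ≤ 4 * arcs f w + ∑[ i ⟵ allFin n ] w i i
max-arcs n w with max-cut n w
... | f , le = pick (≤-total (arcs (not ∘ f) w) (arcs f w))
  where
  F = allFin n
  diag = ∑[ i ⟵ F ] w i i
  cut-arcs : cut f w ≡ arcs f w + arcs (not ∘ f) w
  cut-arcs = trans (∑-cong F λ i → trans (∑-cong F λ j → split (f i) (f j) (w i j)) (∑-+ F _ _)) (∑-+ F _ _)
    where
    split : ∀ a b x → 𝟙 (a xor b) * x ≡ 𝟙 a * 𝟙 (not b) * x + 𝟙 (not a) * 𝟙 (not (not b)) * x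
    split true  true  x = refl
    split true  false x = sym (+-identityʳ _)
    split false true  x = refl
    split false false x = refl
  bound : ∀ x y z → cut f w ≡ x + y → y ≤ x → z ≤ 2 * cut f w + diag → z ≤ 4 * x + diag
  bound x y z eq y≤x le = ≤-trans le (+-monoˡ-≤ diag (≤-trans (*-monoʳ-≤ 2 (≤-trans (≤-reflexive eq) (+-monoʳ-≤ x y≤x)))
    (≤-reflexive (double x))))
    where double : ∀ x → 2 * (x + x) ≡ 4 * x
          double = solve-∀
  pick : _ → ∃ λ f → ∑∑ w ≤ 4 * arcs f w + diag
  pick (inj₁ h) = f , bound (arcs f w) _ _ cut-arcs h le
  pick (inj₂ h) = not ∘ f , bound (arcs (not ∘ f) w) _ _ (trans cut-arcs (+-comm (arcs f w) _)) h le

-- The graph on pairs defined by a properly coloured bipartite block.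

monochromatic-pairs : ∀ {A : Set} {C} (P : List A) (h : A → Fin C) →
  length P * length P ≤ C * ∑[ p ⟵ P ] ∑[ q ⟵ P ] 𝟙 (does (h p ≟ᶠ h q))
monochromatic-pairs {C = C} P h = begin
  length P * length P                              ≤⟨ *-mono-≤ total total ⟩
  ∑ Cs class * ∑ Cs class                          ≤⟨ cauchy-schwarz Cs class ⟩
  length Cs * ∑[ c ⟵ Cs ] (class c * class c)      ≡⟨ cong₂ _*_ (length-allFin C) squares ⟩
  C * ∑[ p ⟵ P ] ∑[ q ⟵ P ] ∑[ c ⟵ Cs ] (is p c * is q c)
    ≤⟨ *-monoʳ-≤ C (∑-mono P λ {p} _ → ∑-mono P λ {q} _ → common p q) ⟩
  C * ∑[ p ⟵ P ] ∑[ q ⟵ P ] 𝟙 (does (h p ≟ᶠ h q)) ∎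
  where
  open ≤-Reasoning
  Cs = allFin C
  is : _ → Fin C → ℕ
  is p c = 𝟙 (does (h p ≟ᶠ c))
  class : Fin C → ℕ
  class c = ∑[ p ⟵ P ] is p c
  total : length P ≤ ∑ Cs class
  total = begin
    length P                         ≡⟨ length-∑ P ⟩
    ∑[ p ⟵ P ] 1                     ≤⟨ ∑-mono P (λ {p} _ → ≤-trans (≤-reflexive (sym (𝟙-yes (h p ≟ᶠ h p) refl))) (∈⇒≤∑ Cs (is p) (∈-allFin (h p)))) ⟩
    ∑[ p ⟵ P ] ∑[ c ⟵ Cs ] is p c    ≡⟨ ∑-swap P Cs _ ⟩
    ∑ Cs class                       ∎
  squares : ∑[ c ⟵ Cs ] (class c * class c) ≡ ∑[ p ⟵ P ] ∑[ q ⟵ P ] ∑[ c ⟵ Cs ] (is p c * is q c)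
  squares = trans (∑-cong Cs λ c → trans (sym (∑-*ʳ P (class c) _)) (∑-cong P λ p → sym (∑-*ˡ P (is p c) _)))
    (trans (∑-swap Cs P _) (∑-cong P λ p → ∑-swap Cs P _))
  common : ∀ p q → ∑[ c ⟵ Cs ] (is p c * is q c) ≤ 𝟙 (does (h p ≟ᶠ h q))
  common p q = by-cases (h p ≟ᶠ h q)
    where
    by-cases : (d : Dec (h p ≡ h q)) → ∑[ c ⟵ Cs ] (is p c * is q c) ≤ 𝟙 (does d)
    by-cases (yes _) = begin
      ∑[ c ⟵ Cs ] (is p c * is q c)  ≤⟨ ∑-mono Cs (λ {c} _ → ≤-trans (*-monoʳ-≤ (is p c) (𝟙≤1 _)) (≤-reflexive (*-identityʳ _))) ⟩
      ∑[ c ⟵ Cs ] is p c             ≤⟨ ∑-at-most-one (λ c → does (h p ≟ᶠ c)) (allFin⁺ C)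
                                          (λ e e′ → trans (sym (does-true (h p ≟ᶠ _) e)) (does-true (h p ≟ᶠ _) e′)) ⟩
      1                              ∎
    by-cases (no ≢) = begin
      ∑[ c ⟵ Cs ] (is p c * is q c)  ≤⟨ ∑-mono Cs (λ {c} _ → 𝟙-does-* (h p ≟ᶠ c) λ p≡c →
                                          ≤-trans (≤-reflexive (sym (*-identityʳ _))) (𝟙-does-* (h q ≟ᶠ c) λ q≡c → ⊥-elim (≢ (trans p≡c (sym q≡c))))) ⟩
      ∑[ c ⟵ Cs ] 0                  ≡⟨ ∑-zero Cs ⟩
      0                              ∎

module Colouring {m C} (g : Fin m → Fin m → Fin C)
  (row-inj : ∀ {a b b′} → g a b ≡ g a b′ → b ≡ b′) (col-inj : ∀ {a a′ b} → g a b ≡ g a′ b → a ≡ a′) where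

  same : Fin m → Fin m → Fin m → Fin m → ℕ
  same a a′ b b′ = 𝟙 (does (g a b ≟ᶠ g a′ b′))

  private
    F = allFin m

    ∑F-one : ∑[ a ⟵ F ] 1 ≡ m
    ∑F-one = trans (sym (length-∑ F)) (length-allFin m)

    ∑F-≤ : ∀ {f : Fin m → ℕ} c → (∀ i → f i ≤ c) → ∑ F f ≤ m * c
    ∑F-≤ c le = ≤-trans (∑-≤const F c λ {i} _ → le i) (≤-reflexive (cong (_* c) (length-allFin m)))

  length-vertices : length (vertices m) ≡ m * m
  length-vertices = trans (length-∑ (vertices m)) (trans (∑-cartesian F F _)
    (trans (∑-cong F λ _ → ∑F-one) (trans (∑-const F m) (cong (_* m) (length-allFin m)))))

  module _ (f h : Fin m → Bool) where

    -- A vertex is a pair of vertices of K_n, one for each of the two copies of H_t; f and h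
    -- keep the first coordinates apart from the second ones, which makes the copies disjoint.
    adjacent : V m → V m → Bool
    adjacent (x₁ , x₂) (y₁ , y₂) =
      (f x₁ ∧ not (f x₂)) ∧ ((h y₁ ∧ not (h y₂)) ∧ does (g x₁ y₁ ≟ᶠ g x₂ y₂))

    adjacent⇒same : ∀ x y → adjacent x y ≡ true → g (proj₁ x) (proj₁ y) ≡ g (proj₂ x) (proj₂ y)
    adjacent⇒same (x₁ , x₂) (y₁ , y₂) e = does-true (g x₁ y₁ ≟ᶠ g x₂ y₂)
      (proj₂ (∧-true {h y₁ ∧ not (h y₂)} (proj₂ (∧-true {f x₁ ∧ not (f x₂)} e))))

    incidence : Incidence m
    incidence = record { adj = adjacent ; clashʳ = clashʳ ; clashˡ = clashˡ }
      where
      clashʳ : ∀ {x y y′} → adjacent x y ≡ true → adjacent x y′ ≡ true → Clash y y′ → y ≡ y′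
      clashʳ {x} {y} {y′} e e′ (inj₁ refl) = cong (proj₁ y ,_)
        (row-inj (trans (sym (adjacent⇒same x y e)) (adjacent⇒same x y′ e′)))
      clashʳ {x} {y} {y′} e e′ (inj₂ refl) = cong (_, proj₂ y)
        (row-inj (trans (adjacent⇒same x y e) (sym (adjacent⇒same x y′ e′))))
      clashˡ : ∀ {x x′ y} → adjacent x y ≡ true → adjacent x′ y ≡ true → Clash x x′ → x ≡ x′
      clashˡ {x} {x′} {y} e e′ (inj₁ refl) = cong (proj₁ x ,_)
        (col-inj (trans (sym (adjacent⇒same x y e)) (adjacent⇒same x′ y e′)))
      clashˡ {x} {x′} {y} e e′ (inj₂ refl) = cong (_, proj₂ x)
        (col-inj (trans (adjacent⇒same x y e) (sym (adjacent⇒same x′ y e′))))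

    edges : ℕ
    edges = ∑[ y ⟵ vertices m ] ∑[ x ⟵ vertices m ] 𝟙 (adjacent x y)

    edges-nested : edges ≡ arcs h (λ b b′ → ∑∑ λ a a′ → 𝟙 (f a) * 𝟙 (not (f a′)) * same a a′ b b′)
    edges-nested = trans (∑-cartesian F F _) (∑-cong F λ b → ∑-cong F λ b′ →
      trans (∑-cartesian F F _) (trans (∑-cong F λ a → trans (∑-cong F λ a′ → factor (f a) (f a′) (h b) (h b′) _)
        (∑-*ˡ F (𝟙 (h b) * 𝟙 (not (h b′))) _)) (∑-*ˡ F (𝟙 (h b) * 𝟙 (not (h b′))) _)))
      where
      factor : ∀ p q r s z → 𝟙 ((p ∧ not q) ∧ ((r ∧ not s) ∧ z)) ≡ 𝟙 r * 𝟙 (not s) * (𝟙 p * 𝟙 (not q) * 𝟙 z)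
      factor false q     r     s     z = sym (*-zeroʳ (𝟙 r * 𝟙 (not s)))
      factor true  true  r     s     z = sym (*-zeroʳ (𝟙 r * 𝟙 (not s)))
      factor true  false false s     z = refl
      factor true  false true  true  z = refl
      factor true  false true  false z = unit (𝟙 z)
        where unit : ∀ z → z ≡ 1 * (1 * z)
              unit = solve-∀

  -- `max-arcs` is applied to the branch coordinates, then to the subdivision coordinates on what is
  -- left. Each application costs a factor 4. Each diagonal is at most m², since equal colours in
  -- one row or column force equality; together they give 4m² + m².
  dense-cut : ∃ λ f → ∃ λ h → (m * m) * (m * m) ≤ C * (16 * edges f h + 5 * (m * m))
  dense-cut with max-arcs m (λ a a′ → ∑∑ λ b b′ → same a a′ b b′)
  ... | f , le₁ with max-arcs m (λ b b′ → ∑∑ λ a a′ → 𝟙 (f a) * 𝟙 (not (f a′)) * same a a′ b b′)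
  ...   | h , le₂ = f , h , (begin
    (m * m) * (m * m)
      ≡⟨ cong₂ _*_ length-vertices length-vertices ⟨
    length (vertices m) * length (vertices m)
      ≤⟨ monochromatic-pairs (vertices m) (λ p → g (proj₁ p) (proj₂ p)) ⟩
    C * ∑[ p ⟵ vertices m ] ∑[ q ⟵ vertices m ] same (proj₁ p) (proj₁ q) (proj₂ p) (proj₂ q)
      ≡⟨ cong (C *_) unfold ⟩
    C * ∑∑ (λ a a′ → ∑∑ λ b b′ → same a a′ b b′)
      ≤⟨ *-monoʳ-≤ C (≤-trans le₁ (+-mono-≤ (*-monoʳ-≤ 4 (≤-trans (≤-reflexive refold) (≤-trans le₂
           (+-mono-≤ (≤-reflexive (cong (4 *_) (sym (edges-nested f h)))) (∑F-≤ m λ b → diag₂ b))))) (∑F-≤ m diag₁))) ⟩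
    C * (4 * (4 * edges f h + m * m) + m * m)
      ≡⟨ cong (C *_) (collect (edges f h) (m * m)) ⟩
    C * (16 * edges f h + 5 * (m * m)) ∎)
    where
    open ≤-Reasoning
    collect : ∀ e n → 4 * (4 * e + n) + n ≡ 16 * e + 5 * n
    collect = solve-∀
    unfold : ∑[ p ⟵ vertices m ] ∑[ q ⟵ vertices m ] same (proj₁ p) (proj₁ q) (proj₂ p) (proj₂ q)
           ≡ ∑∑ (λ a a′ → ∑∑ λ b b′ → same a a′ b b′)
    unfold = trans (∑-cartesian F F _) (∑-cong F λ a → trans (∑-cong F λ b → ∑-cartesian F F _) (∑-swap F F _))
    refold : arcs f (λ a a′ → ∑∑ λ b b′ → same a a′ b b′)
           ≡ ∑∑ (λ b b′ → ∑∑ λ a a′ → 𝟙 (f a) * 𝟙 (not (f a′)) * same a a′ b b′)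
    refold = trans (∑-cong F λ a → trans (∑-cong F λ a′ → pull a a′) (trans (∑-swap F F _) (∑-cong F λ b → ∑-swap F F _)))
                   (trans (∑-swap F F _) (∑-cong F λ b → ∑-swap F F _))
      where
      pull : ∀ a a′ → 𝟙 (f a) * 𝟙 (not (f a′)) * ∑∑ (same a a′) ≡ ∑∑ λ b b′ → 𝟙 (f a) * 𝟙 (not (f a′)) * same a a′ b b′
      pull a a′ = trans (sym (∑-*ˡ F (𝟙 (f a) * 𝟙 (not (f a′))) _)) (∑-cong F λ b → sym (∑-*ˡ F (𝟙 (f a) * 𝟙 (not (f a′))) _))
    diag₁ : ∀ a → ∑∑ (same a a) ≤ m
    diag₁ a = ≤-trans (∑F-≤ 1 λ b → ∑-at-most-one (λ b′ → does (g a b ≟ᶠ g a b′)) (allFin⁺ m)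
      λ e e′ → row-inj (trans (sym (does-true (g a b ≟ᶠ g a _) e)) (does-true (g a b ≟ᶠ g a _) e′))) (≤-reflexive (*-identityʳ m))
    diag₂ : ∀ b → ∑∑ (λ a a′ → 𝟙 (f a) * 𝟙 (not (f a′)) * same a a′ b b) ≤ m
    diag₂ b = ≤-trans (∑F-≤ 1 λ a → ≤-trans
        (∑-mono F λ {a′} _ → ≤-trans (*-monoˡ-≤ (same a a′ b b) (*-mono-≤ (𝟙≤1 (f a)) (𝟙≤1 (not (f a′))))) (≤-reflexive (*-identityˡ _)))
        (∑-at-most-one (λ a′ → does (g a b ≟ᶠ g a′ b)) (allFin⁺ m)
          λ e e′ → col-inj (trans (sym (does-true (g a b ≟ᶠ g _ b) e)) (does-true (g a b ≟ᶠ g _ b) e′)))) (≤-reflexive (*-identityʳ m))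

-- From a subdivision back to two copies in the complete graph.

module Halves m {n} (m+m≤n : m + m ≤ n) where

  row col : Fin m → Fin n
  row a = inject≤ (a ↑ˡ m) m+m≤n
  col b = inject≤ (m ↑ʳ b) m+m≤n

  row-injective : ∀ {a a′} → row a ≡ row a′ → a ≡ a′
  row-injective e = ↑ˡ-injective m _ _ (inject≤-injective m+m≤n m+m≤n _ _ e)

  col-injective : ∀ {b b′} → col b ≡ col b′ → b ≡ b′
  col-injective e = ↑ʳ-injective m _ _ (inject≤-injective m+m≤n m+m≤n _ _ e)

  row≢col : ∀ {a b} → row a ≢ col b
  row≢col {a} {b} e
    with trans (sym (splitAt-↑ˡ m a m)) (trans (cong (splitAt m) (inject≤-injective m+m≤n m+m≤n _ _ e)) (splitAt-↑ʳ m m b))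
  ... | ()

module _ m {n C} (m+m≤n : m + m ≤ n) (c : EdgeColouring n C) (proper : Proper c) where
  open Halves m m+m≤n

  block : Fin m → Fin m → Fin C
  block a b = c (row a) (col b)

  block-row-inj : ∀ {a b b′} → block a b ≡ block a b′ → b ≡ b′
  block-row-inj {a} {b} {b′} e with b ≟ᶠ b′
  ... | yes p = p
  ... | no b≢b′ = ⊥-elim (proj₂ proper (row a) (col b) (col b′) row≢col row≢col (b≢b′ ∘ col-injective) e)

  block-col-inj : ∀ {a a′ b} → block a b ≡ block a′ b → a ≡ a′
  block-col-inj {a} {a′} {b} e with a ≟ᶠ a′
  ... | yes p = p
  ... | no a≢a′ = ⊥-elim (proj₂ proper (col b) (row a) (row a′) (row≢col ∘ sym) (row≢col ∘ sym) (a≢a′ ∘ row-injective)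
    (trans (sym (proj₁ proper (row a) (col b) row≢col)) (trans e (proj₁ proper (row a′) (col b) row≢col))))

  open Colouring block block-row-inj block-col-inj

  module _ (f h : Fin m → Bool) {r} (S : Incidence.Subdivision (incidence f h) (2 + r)) where
    open Incidence.Subdivision S
    private
      t = 2 + r

      sides : ∀ x y → adjacent f h x y ≡ true →
        f (proj₁ x) ≡ true × f (proj₂ x) ≡ false × h (proj₁ y) ≡ true × h (proj₂ y) ≡ false
      sides (x₁ , x₂) (y₁ , y₂) e with f x₁ | f x₂ | h y₁ | h y₂
      ... | true | false | true | false = refl , refl , refl , refl

      -- Only an edge reveals the side of a branch vertex; with at least two branch vertices each
      -- one lies on an edge, taken here towards the pair with vertex 0.
      u-sides : ∀ i → f (proj₁ (u i)) ≡ true × f (proj₂ (u i)) ≡ false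
      u-sides zero    = let a , b , _ = sides _ _ (adj-lo zero (suc zero) z<s) in a , b
      u-sides (suc i) = let a , b , _ = sides _ _ (adj-hi zero (suc i) z<s) in a , b

      ye : Pair t → V m
      ye ((i , j) , p) = y i j p

      y-sides : ∀ e → h (proj₁ (ye e)) ≡ true × h (proj₂ (ye e)) ≡ false
      y-sides ((i , j) , p) = let _ , _ , a , b = sides _ _ (adj-lo i j p) in a , b

      ye-inj : ∀ e e′ → Clash (ye e) (ye e′) → e ≡ e′
      ye-inj ((i , j) , p) ((i′ , j′) , p′) cl with y-inj i j p i′ j′ p′ cl
      ... | refl , refl = cong ((i , j) ,_) (<-irrelevant p p′)

      -- The two projections give the two copies. Branch vertices go to one half and subdivision
      -- vertices to the other, so the two kinds never collide.
      place : (V m → Fin m) → SubdivVertex t → Fin n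
      place π (inj₁ i) = row (π (u i))
      place π (inj₂ e) = col (π (ye e))

      place-inj : ∀ π → (∀ {a b} → π a ≡ π b → Clash a b) → ∀ {x y} → place π x ≡ place π y → x ≡ y
      place-inj π cl {inj₁ i} {inj₁ j}  e = cong inj₁ (u-inj i j (cl (row-injective e)))
      place-inj π cl {inj₁ i} {inj₂ _}  e = ⊥-elim (row≢col e)
      place-inj π cl {inj₂ _} {inj₁ j}  e = ⊥-elim (row≢col (sym e))
      place-inj π cl {inj₂ p} {inj₂ p′} e = cong inj₂ (ye-inj p p′ (cl (col-injective e)))

      opposite : ∀ {A : Set} (f : A → Bool) {a b} → f a ≡ true → f b ≡ false → a ≢ b
      opposite f fa fb refl with trans (sym fa) fb
      ... | ()

      disjoint : ∀ x y → place proj₁ x ≢ place proj₂ y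
      disjoint (inj₁ i) (inj₁ j) e = opposite f (proj₁ (u-sides i)) (proj₂ (u-sides j)) (row-injective e)
      disjoint (inj₁ i) (inj₂ q) e = row≢col e
      disjoint (inj₂ p) (inj₁ j) e = row≢col (sym e)
      disjoint (inj₂ p) (inj₂ q) e = opposite h (proj₁ (y-sides p)) (proj₂ (y-sides q)) (col-injective e)

    subdivision⇒Contains2 : Contains2 t c
    subdivision⇒Contains2 =
      (place proj₁ , place-inj proj₁ inj₁) , (place proj₂ , place-inj proj₂ inj₂) , disjoint ,
      λ { ((i , j) , p) → adjacent⇒same f h _ _ (adj-lo i j p) , adjacent⇒same f h _ _ (adj-hi i j p) }

-- Constants and the final bound.

heaviness density : ℕ → ℕ
heaviness t = t * t * 2
density t = 16 * t * heaviness t * (32 * max-obstruction t (heaviness t))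

heaviness-pos : ∀ t → 0 < t → 0 < heaviness t
heaviness-pos t 0<t = *-mono-≤ (*-mono-≤ 0<t 0<t) (s≤s {0} {1} z≤n)

density-pos : ∀ t → 0 < t → 0 < density t
density-pos t 0<t = *-mono-≤ (*-mono-≤ (*-mono-≤ (s≤s {0} {15} z≤n) 0<t) (heaviness-pos t 0<t))
  (*-mono-≤ (s≤s {0} {31} z≤n) (max-obstruction-pos t (heaviness t) 0<t (heaviness-pos t 0<t)))

-- With few colours the diagonal term takes at most half of N², so E is at least N² / (32 C);
-- substituting the bound on `C` gives the claim, with 256 = 32 * 8.
density-hypothesis : ∀ r g N C E → 0 < g → 0 < N → N * N ≤ C * (16 * E + 5 * N) →
  (256 * g * C) ^ suc (2 * r) ≤ N ^ suc r → (8 * g * N) ^ suc (2 * r) * N ^ r ≤ E ^ suc (2 * r)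
density-hypothesis r g N C E 0<g 0<N N²≤ few =
  *-cancelˡ-≤ ((32 * C) ^ a) {{m^n≢0 (32 * C) a {{32C≢0}}}} (begin
    (32 * C) ^ a * ((8 * g * N) ^ a * N ^ r)    ≡⟨ *-assoc ((32 * C) ^ a) _ (N ^ r) ⟨
    (32 * C) ^ a * (8 * g * N) ^ a * N ^ r      ≡⟨ cong (_* N ^ r) (^-distribʳ-* (32 * C) (8 * g * N) a) ⟨
    (32 * C * (8 * g * N)) ^ a * N ^ r          ≡⟨ cong (λ z → z ^ a * N ^ r) (merge C g N) ⟩
    (256 * g * C * N) ^ a * N ^ r               ≡⟨ cong (_* N ^ r) (^-distribʳ-* (256 * g * C) N a) ⟩
    (256 * g * C) ^ a * N ^ a * N ^ r           ≤⟨ *-monoˡ-≤ (N ^ r) (*-monoˡ-≤ (N ^ a) few) ⟩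
    N ^ suc r * N ^ a * N ^ r                   ≡⟨ powers ⟩
    (N * N) ^ a                                 ≤⟨ ^-monoˡ-≤ a N²≤32CE ⟩
    (32 * C * E) ^ a                            ≡⟨ ^-distribʳ-* (32 * C) E a ⟩
    (32 * C) ^ a * E ^ a                        ∎)
  where
  open ≤-Reasoning
  a : ℕ
  a = suc (2 * r)
  instance
    N≢0 : NonZero N
    N≢0 = >-nonZero 0<N
  merge : ∀ C g N → 32 * C * (8 * g * N) ≡ 256 * g * C * N
  merge = solve-∀
  powers : N ^ suc r * N ^ a * N ^ r ≡ (N * N) ^ a
  powers = trans (rot (N ^ suc r) (N ^ a) (N ^ r)) (trans (cong (_* N ^ a) (trans (sym (^-distribˡ-+-* N (suc r) r))
    (cong (λ z → N ^ suc (r + z)) (sym (+-identityʳ r))))) (sym (^-distribʳ-* N N a)))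
    where rot : ∀ x y z → x * y * z ≡ x * z * y
          rot = solve-∀
  -- As r + 1 is at most 2r + 1, the bound on `C` already forces 256 g C to be at most N.
  10C≤N : 10 * C ≤ N
  10C≤N = ≤-trans (*-monoˡ-≤ C (≤-trans (m≤m+n 10 246) (m≤m*n 256 g {{>-nonZero 0<g}})))
    (^-cancelˡ-≤ (2 * r) (≤-trans few (^-monoʳ-≤ N (s≤s (m≤n*m r 2)))))
  N²≤32CE : N * N ≤ 32 * C * E
  N²≤32CE = +-cancelʳ-≤ (N * N) _ _ (begin
    N * N + N * N                          ≡⟨ cong (N * N +_) (+-identityʳ _) ⟨
    2 * (N * N)                            ≤⟨ *-monoʳ-≤ 2 N²≤ ⟩
    2 * (C * (16 * E + 5 * N))             ≡⟨ spread C E N ⟩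
    32 * C * E + 10 * C * N                ≤⟨ +-monoʳ-≤ _ (*-monoˡ-≤ N 10C≤N) ⟩
    32 * C * E + N * N                     ∎)
    where spread : ∀ C E N → 2 * (C * (16 * E + 5 * N)) ≡ 32 * C * E + 10 * C * N
          spread = solve-∀
  32C≢0 : NonZero (32 * C)
  32C≢0 = ≢-nonZero λ e → <⇒≱ (*-mono-≤ 0<N 0<N) (≤-trans N²≤32CE (≤-reflexive (cong (_* E) e)))

-- If the inequality failed, the graph on the m² pairs, m being half of n, would be dense enough to
-- contain a subdivision. The power of 3 covers the rounding, as n ≤ 3m.
lower-bound : ∀ r → 1 ≤ r → ∀ n C → 2 ≤ n → Admissible2 (2 + r) n C →
  n ^ (2 * suc r) ≤ 3 ^ (2 * suc r) * (256 * density (2 + r)) ^ suc (2 * r) * C ^ suc (2 * r)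
lower-bound r 1≤r n C 2≤n (c , proper , no-copies) = ≮⇒≥ λ lt →
  let f , h , dense = dense-cut in
  dense⇒subdivision (incidence f h) 0<m r t s g (m * m) 1≤r refl z<s ≤-refl z<s 0<g refl length-vertices
    (density-hypothesis r g (m * m) C (edges f h) 0<g (*-mono-≤ 0<m 0<m) dense (few lt))
    (λ S → no-copies (subdivision⇒Contains2 m m+m≤n c proper f h S))
  where
  open ≤-Reasoning
  m t s g a b : ℕ
  m = n / 2
  t = 2 + r
  s = heaviness t
  g = density t
  a = suc (2 * r)
  b = 2 * suc r
  m+m≤n : m + m ≤ n
  m+m≤n = ≤-trans (≤-reflexive (trans (cong (m +_) (sym (+-identityʳ m))) (*-comm 2 m))) (m/n*n≤m n 2)
  open Colouring (block m m+m≤n c proper) (block-row-inj m m+m≤n c proper) (block-col-inj m m+m≤n c proper)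
    using (incidence; edges; dense-cut; length-vertices)
  0<m : 0 < m
  0<m = m≥n⇒m/n>0 2≤n
  0<g : 0 < g
  0<g = density-pos t z<s
  n≤3m : n ≤ 3 * m
  n≤3m = begin
    n                  ≡⟨ m≡m%n+[m/n]*n n 2 ⟩
    n % 2 + m * 2      ≤⟨ +-mono-≤ (s≤s⁻¹ (m%n<n n 2)) (≤-reflexive (*-comm m 2)) ⟩
    1 + 2 * m          ≤⟨ +-monoˡ-≤ (2 * m) 0<m ⟩
    3 * m              ∎
  few : 3 ^ b * (256 * g) ^ a * C ^ a < n ^ b → (256 * g * C) ^ a ≤ (m * m) ^ suc r
  few lt = *-cancelˡ-≤ (3 ^ b) {{m^n≢0 3 b}} (begin
    3 ^ b * (256 * g * C) ^ a        ≡⟨ cong (3 ^ b *_) (^-distribʳ-* (256 * g) C a) ⟩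
    3 ^ b * ((256 * g) ^ a * C ^ a)  ≡⟨ *-assoc (3 ^ b) _ _ ⟨
    3 ^ b * (256 * g) ^ a * C ^ a    ≤⟨ <⇒≤ lt ⟩
    n ^ b                            ≤⟨ ^-monoˡ-≤ b n≤3m ⟩
    (3 * m) ^ b                      ≡⟨ ^-distribʳ-* 3 m b ⟩
    3 ^ b * m ^ b                    ≡⟨ cong (3 ^ b *_) (^-*-assoc m 2 (suc r)) ⟨
    3 ^ b * (m ^ 2) ^ suc r          ≡⟨ cong (λ z → 3 ^ b * (m * z) ^ suc r) (*-identityʳ m) ⟩
    3 ^ b * (m * m) ^ suc r          ∎)

-- Taking (2t-3)-th roots gives the stated growth, as (2t-2)/(2t-3) = 1 + 1/(2t-3); a bound for
-- every admissible `C` bounds the least one.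
theorem1p4 : (t : ℕ) → 3 ≤ t →
    Σ ℕ λ d → 1 ≤ d × Σ ℕ λ N → ∀ (n C : ℕ) → N ≤ n → Admissible2 t n C →
    n ^ (2 * t ∸ 2) ≤ d * C ^ (2 * t ∸ 3)
theorem1p4 t@(suc (suc r)) (s≤s (s≤s 1≤r)) =
  d , 0<d , 2 , λ n C 2≤n adm → subst₂ (λ a b → n ^ a ≤ d * C ^ b) (sym exp₁) (sym exp₂) (lower-bound r 1≤r n C 2≤n adm)
  where
  d : ℕ
  d = 3 ^ (2 * suc r) * (256 * density t) ^ suc (2 * r)
  0<d : 0 < d
  0<d = *-mono-≤ (m^n>0 3 (2 * suc r)) (m^n>0 (256 * density t) {{>-nonZero (*-mono-≤ (s≤s {0} {255} z≤n) (density-pos t z<s))}} (suc (2 * r)))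
  exp₁ : 2 * t ∸ 2 ≡ 2 * suc r
  exp₁ = cong (_∸ 2) (*-suc 2 (suc r))
  exp₂ : 2 * t ∸ 3 ≡ suc (2 * r)
  exp₂ = cong (_∸ 3) (trans (*-suc 2 (suc r)) (cong (2 +_) (*-suc 2 r)))
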